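{- Let $m\ge1$, let $T\subseteq\{0,\ldots,m-1\}$, $s=|T|$, and consider the Frobenius-factorized reduction algorithm modulo $g=x^m+\sum_{t\in T}x^t\in\mathbb{F}_2[x]$, with the quantities $r$, $h_k$, $\ell_t$, $S_{\mathrm{fb}}$, $W_{\mathrm{fb}}$, $W_V$ defined in the context. The number $S_{\mathrm{fb}}$ of stored feedback shifts and the feedback contribution work $W_{\mathrm{fb}}$ are, respectively, $$S_{\mathrm{fb}}=\sum_{k=0}^{r-1}h_k=\sum_{t\in T}\ell_t,$$ $$W_{\mathrm{fb}}=\sum_{t\in T}\sum_{k\ge0}[m-2^k\Delta_t]_+,\qquad [z]_+=\max\{z,0\}.$$ The final low-part assembly has scheduled coefficient work $$W_V=\sum_{t\in T}(m-t)=\sum_{t\in T}\Delta_t.$$ If $s\ge1$, then $$S_{\mathrm{fb}}\le s+\log_2\frac{m^s}{s!}\le s\left(1+\log_2\frac{em}{s}\right),$$ $$W_{\mathrm{fb}}\le mS_{\mathrm{fb}}=O\!\left(ms\left(1+\log\frac{m}{s}\right)\right),$$ $$W_{\mathrm{fb}}+W_V=O\!\left(ms\left(1+\log\frac{m}{s}\right)\right).$$ The inequality $W_{\mathrm{fb}}\le mS_{\mathrm{fb}}$ is strict whenever $U\ne0$.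
   Context: For $t\in T$ put $\Delta_t=m-t$. For $d\ge 0$, $N^d$ is the truncated right shift on $\mathbb{F}_2^m$: $(N^dy)_i=y_{i+d}$ if $0\le i<m-d$ and $(N^dy)_i=0$ if $m-d\le i<m$; $N^d=0$ for $d\ge m$. Put $U=\sum_{t\in T}N^{\Delta_t}$ and $V(Y)=\sum_{t\in T}(x^tY\bmod x^m)$ for $\deg Y<m$ (polynomials of degree below $m$ are identified with vectors in $\mathbb{F}_2^m$; empty sums are zero). If $T\subseteq\{0\}$ (equivalently $U=0$) set $r=0$; otherwise $\Delta_{\min}=\min\{\Delta_t:t\in T\}$ and $r=\lceil\log_2(m/\Delta_{\min})\rceil$. For $k\ge0$ let $T_k=\{t\in T:2^k\Delta_t<m\}$, $h_k=|T_k|$, and for $t\in T$ let $\ell_t=\#\{k\ge0:2^k\Delta_t<m\}=\lceil\log_2(m/\Delta_t)\rceil$. Frobenius-factorized reduction algorithm on input $A=L+x^mH$ ($\deg L,\deg H<m$): set $Y\leftarrow H$; for $k=0,\ldots,r-1$ synchronously replace $Y$ by $Y+\sum_{t\in T_k}N^{2^k\Delta_t}Y$ (all shifts read the same stage input); return $L+V(Y)$. Scheduled coefficient contributions: adding one shifted source coefficient to one destination coefficient costs one unit; retaining the unshifted stage input, copying, testing bounds and reading schedule descriptors are not counted. A feedback shift by $d<m$ contributes to the destination positions $0\le i<m-d$ (from source position $i+d$); a low-assembly term $x^tY\bmod x^m$ contributes from the source positions $0\le i<m-t$ (to destination $i+t$). $S_{\mathrm{fb}}$ is the number of stored feedback shifts,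 i.e. of pairs $(k,t)$ with $0\le k<r$ and $t\in T_k$. $W_{\mathrm{fb}}$ is the total number of scheduled coefficient contributions in all feedback stages $k=0,\ldots,r-1$, and $W_V$ is the number of scheduled coefficient contributions in the evaluation of $V(Y)$ in the final assembly. The implied constants in $O(\cdot)$ are absolute; $e$ is the base of the natural logarithm. -}

module Defs where

open import Algebra.Definitions.RawSemiring using ()
open import Data.Fin.Base using (Fin; toℕ; fromℕ<)
open import Data.Fin.Properties using (toℕ<n)
open import Data.Fin.Subset using (Subset; _∈_)
open import Data.Fin.Subset.Properties using (_∈?_)
open import Data.Integer.Base as ℤ using (ℤ; +_; -[1+_])
import Data.Integer.Properties as ℤ
open import Data.List.Base
  using (List; map; concatMap; mapMaybe; filter; length; allFin; upTo; foldr)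
open import Data.List.Extrema.Nat using (min; v<min⁺)
import Data.List.Relation.Unary.All as All
import Data.List.Relation.Unary.All.Properties as All
open import Data.Maybe.Base as Maybe using ()
open import Data.Nat.Base as ℕ using (ℕ; zero; suc; NonZero; _!)
open import Data.Nat.ListAction using (sum)
import Data.Nat.Properties as ℕ
open import Data.Nat.Solver using (module +-*-Solver)
open import Data.Parity.Base as ℙ using (Parity; 0ℙ)
open import Data.Product.Base using (∃; ∃-syntax; _×_; _,_; proj₁; proj₂)
open import Data.Rational.Unnormalised.Base as ℚ
  using (ℚᵘ; mkℚᵘ; 0ℚᵘ; ½; ↥_; ↧ₙ_; *≤*; *<*; *≡*)
import Data.Rational.Unnormalised.Properties as ℚ
open import Data.Vec.Functional using (Vector; updateAt)
open import Relation.Binary.PropositionalEquality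
  using (_≡_; refl; sym; cong; subst₂)
open import Relation.Nullary using (¬_; yes; no)
open import Relation.Nullary.Decidable.Core using (dec⇒maybe)

open Algebra.Definitions.RawSemiring ℚ.+-*-rawSemiring public
  using () renaming (_^_ to _^ℚ_)

-- A real number is a Dedekind cut, given by its lower class: a nonempty
-- set of rationals, bounded above, closed downwards, without a largest
-- element.

record ℝ : Set₁ where
  field
    lower     : ℚᵘ → Set
    inhabited : ∃ lower
    bounded   : ∃[ b ] (∀ {q} → lower q → q ℚ.≤ b)
    closed    : ∀ {p q} → p ℚ.< q → lower q → lower p
    open′     : ∀ {p} → lower p → ∃[ q ] (lower q × p ℚ.< q)

open ℝ public

infix  4 _≤ℝ_
infixl 6 _+ℝ_
infixl 7 _·_ _÷_

_≤ℝ_ : ℝ → ℝ → Set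
x ≤ℝ y = ∀ {q} → lower x q → lower y q

Positive : ℝ → Set
Positive x = lower x 0ℚᵘ

sup : (S : ℚᵘ → Set) → ∃ S → ∃[ b ] (∀ {q} → S q → q ℚ.≤ b) → ℝ
sup S (s , s∈S) (b , S≤b) = record
  { lower     = λ q → ∃[ p ] (S p × q ℚ.< p)
  ; inhabited = s ℚ.- ℚ.1ℚᵘ , s , s∈S , s-1<s
  ; bounded   = b , λ (p , p∈S , q<p) → ℚ.≤-trans (ℚ.<⇒≤ q<p) (S≤b p∈S)
  ; closed    = λ p<q (t , t∈S , q<t) → t , t∈S , ℚ.<-trans p<q q<t
  ; open′     = λ (t , t∈S , p<t) → let (u , p<u , u<t) = ℚ.<-dense p<t in
                u , (t , t∈S , u<t) , p<u
  }
  where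
  s-1<s : s ℚ.- ℚ.1ℚᵘ ℚ.< s
  s-1<s = ℚ.<-respʳ-≃ (ℚ.+-identityʳ s)
    (ℚ.+-monoʳ-< s (ℚ.negative⁻¹ (ℚ.- ℚ.1ℚᵘ)))

fromℚ : ℚᵘ → ℝ
fromℚ q = sup (_≡ q) (q , refl) (q , ℚ.≤-reflexive-≡)

fromℤ : ℤ → ℝ
fromℤ z = fromℚ (z ℚ./ 1)

fromℕ : ℕ → ℝ
fromℕ n = fromℤ (+ n)

_+ℝ_ : ℝ → ℝ → ℝ
x +ℝ y = sup (λ q → ∃[ a ] ∃[ b ] (lower x a × lower y b × q ≡ a ℚ.+ b))
  (let (a , a<x) = inhabited x
       (b , b<y) = inhabited y
   in a ℚ.+ b , a , b , a<x , b<y , refl)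
  (let (a , x≤a) = bounded x
       (b , y≤b) = bounded y
   in a ℚ.+ b , λ { (_ , _ , c<x , d<y , refl) → ℚ.+-mono-≤ (x≤a c<x) (y≤b d<y) })

_·_ : ℕ → ℝ → ℝ
n · x = sup (λ q → ∃[ a ] (lower x a × q ≡ (+ n ℚ./ 1) ℚ.* a))
  (let (a , a<x) = inhabited x in (+ n ℚ./ 1) ℚ.* a , a , a<x , refl)
  (let (b , x≤b) = bounded x
   in (+ n ℚ./ 1) ℚ.* b
    , λ { (_ , a<x , refl) → ℚ.*-monoʳ-≤-nonNeg (+ n ℚ./ 1) (x≤b a<x) })

_÷_ : ℝ → (n : ℕ) .{{_ : NonZero n}} → ℝ
x ÷ n@(suc _) = sup (λ q → ∃[ a ] (lower x a × q ≡ (+ 1 ℚ./ n) ℚ.* a))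
  (let (a , a<x) = inhabited x in (+ 1 ℚ./ n) ℚ.* a , a , a<x , refl)
  (let (b , x≤b) = bounded x
   in (+ 1 ℚ./ n) ℚ.* b
    , λ { (_ , a<x , refl) → ℚ.*-monoʳ-≤-nonNeg (+ 1 ℚ./ n) (x≤b a<x) })

IsCeiling : ℝ → ℤ → Set
IsCeiling x n = x ≤ℝ fromℤ n × (∀ k → x ≤ℝ fromℤ k → n ℤ.≤ k)

fromℕ-positive : ∀ n .{{_ : NonZero n}} → Positive (fromℕ n)
fromℕ-positive n@(suc _) = + n ℚ./ 1 , refl , ℚ.positive⁻¹ (+ n ℚ./ 1)

·-positive : ∀ n .{{_ : NonZero n}} {x} → Positive x → Positive (n · x)
·-positive n@(suc _) {x} 0<x with open′ x 0<x
... | a , a<x , 0<a = (+ n ℚ./ 1) ℚ.* a , (a , a<x , refl) ,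
  ℚ.<-respˡ-≃ (ℚ.*-zeroʳ (+ n ℚ./ 1)) (ℚ.*-monoʳ-<-pos (+ n ℚ./ 1) 0<a)

÷-positive : ∀ {x} n .{{_ : NonZero n}} → Positive x → Positive (x ÷ n)
÷-positive {x} n@(suc _) 0<x with open′ x 0<x
... | a , a<x , 0<a = (+ 1 ℚ./ n) ℚ.* a , (a , a<x , refl) ,
  ℚ.<-respˡ-≃ (ℚ.*-zeroʳ (+ 1 ℚ./ n)) (ℚ.*-monoʳ-<-pos (+ 1 ℚ./ n) 0<a)

1/!_ : ℕ → ℚᵘ
1/! n = (+ 1 ℚ./ n !) {{n ℕ.!≢0}}

e-partial : ℕ → ℚᵘ
e-partial zero    = 1/! 0
e-partial (suc n) = e-partial n ℚ.+ 1/! suc n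

1/k+1/k≤1/n : ∀ k n .{{_ : NonZero k}} .{{_ : NonZero n}} → 2 ℕ.* n ℕ.≤ k →
              + 1 ℚ./ k ℚ.+ + 1 ℚ./ k ℚ.≤ + 1 ℚ./ n
1/k+1/k≤1/n k@(suc _) n@(suc _) 2n≤k = *≤* (ℤ.+≤+ (begin
  (k ℕ.+ 0 ℕ.+ (k ℕ.+ 0)) ℕ.* n ≡⟨ solve 2 (λ k n → (k :+ con 0 :+ (k :+ con 0)) :* n := k :* (con 2 :* n)) refl k n ⟩
  k ℕ.* (2 ℕ.* n)               ≤⟨ ℕ.*-monoʳ-≤ k 2n≤k ⟩
  k ℕ.* k                       ≡⟨ ℕ.+-identityʳ (k ℕ.* k) ⟨
  k ℕ.* k ℕ.+ 0                 ∎))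
  where open ℕ.≤-Reasoning
        open +-*-Solver

e-partial+1/!≤3 : ∀ n → e-partial (suc n) ℚ.+ 1/! suc n ℚ.≤ + 3 ℚ./ 1
e-partial+1/!≤3 zero    = *≤* ℤ.≤-refl
e-partial+1/!≤3 (suc n) = begin
  e-partial (suc n) ℚ.+ 1/! suc (suc n) ℚ.+ 1/! suc (suc n)
    ≃⟨ ℚ.+-assoc (e-partial (suc n)) (1/! suc (suc n)) (1/! suc (suc n)) ⟩
  e-partial (suc n) ℚ.+ (1/! suc (suc n) ℚ.+ 1/! suc (suc n))
    ≤⟨ ℚ.+-monoʳ-≤ (e-partial (suc n))
         (1/k+1/k≤1/n (suc (suc n) !) (suc n !) {{suc (suc n) ℕ.!≢0}} {{suc n ℕ.!≢0}}
           (ℕ.*-monoˡ-≤ (suc n !) {2} {suc (suc n)} (ℕ.s≤s (ℕ.s≤s ℕ.z≤n)))) ⟩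
  e-partial (suc n) ℚ.+ 1/! suc n
    ≤⟨ e-partial+1/!≤3 n ⟩
  + 3 ℚ./ 1 ∎
  where open ℚ.≤-Reasoning

1/!-nonNeg : ∀ n → 0ℚᵘ ℚ.≤ 1/! n
1/!-nonNeg n = go (n !) {{n ℕ.!≢0}}
  where
  go : ∀ k .{{_ : NonZero k}} → 0ℚᵘ ℚ.≤ + 1 ℚ./ k
  go (suc k) = ℚ.nonNegative⁻¹ (+ 1 ℚ./ suc k)

e-partial≤3 : ∀ n → e-partial n ℚ.≤ + 3 ℚ./ 1
e-partial≤3 n = begin
  e-partial n                           ≃⟨ ℚ.+-identityʳ (e-partial n) ⟨
  e-partial n ℚ.+ 0ℚᵘ                   ≤⟨ ℚ.+-monoʳ-≤ (e-partial n) (1/!-nonNeg (suc n)) ⟩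
  e-partial (suc n)                     ≃⟨ ℚ.+-identityʳ (e-partial (suc n)) ⟨
  e-partial (suc n) ℚ.+ 0ℚᵘ             ≤⟨ ℚ.+-monoʳ-≤ (e-partial (suc n)) (1/!-nonNeg (suc n)) ⟩
  e-partial (suc n) ℚ.+ 1/! suc n       ≤⟨ e-partial+1/!≤3 n ⟩
  + 3 ℚ./ 1                             ∎
  where open ℚ.≤-Reasoning

e : ℝ
e = sup (λ q → ∃[ n ] (q ≡ e-partial n))
  (e-partial 0 , 0 , refl)
  (+ 3 ℚ./ 1 , λ { (n , refl) → e-partial≤3 n })

e-positive : Positive e
e-positive = e-partial 0 , (0 , refl) , ℚ.positive⁻¹ (e-partial 0)

2ℚ : ℚᵘ
2ℚ = + 2 ℚ./ 1

2^_ : ℤ → ℚᵘ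
2^ (+ n)    = 2ℚ ^ℚ n
2^ -[1+ n ] = ½ ^ℚ suc n

ι : ℕ → ℚᵘ
ι n = + n ℚ./ 1

ι-mono-≤ : ∀ {m n} → m ℕ.≤ n → ι m ℚ.≤ ι n
ι-mono-≤ m≤n = *≤* (ℤ.*-monoʳ-≤-nonNeg (+ 1) (ℤ.+≤+ m≤n))

ι-cancel-≤ : ∀ {m n} → ι m ℚ.≤ ι n → m ℕ.≤ n
ι-cancel-≤ {m} {n} (*≤* m≤n) =
  ℤ.drop‿+≤+ (subst₂ ℤ._≤_ (ℤ.*-identityʳ (+ m)) (ℤ.*-identityʳ (+ n)) m≤n)

ι-^ : ∀ m n → ι m ^ℚ n ℚ.≃ ι (m ℕ.^ n)
ι-^ m zero    = ℚ.≃-refl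
ι-^ m (suc n) = ℚ.≃-trans (ℚ.*-congˡ {ι m} (ι-^ m n))
  (*≡* (cong (ℤ._* + 1) (sym (ℤ.pos-* m (m ℕ.^ n)))))

^ℚ-nonNeg : ∀ {y} → 0ℚᵘ ℚ.≤ y → ∀ n → 0ℚᵘ ℚ.≤ y ^ℚ n
^ℚ-nonNeg 0≤y zero    = ℚ.nonNegative⁻¹ ℚ.1ℚᵘ
^ℚ-nonNeg {y} 0≤y (suc n) = ℚ.nonNegative⁻¹ (y ℚ.* (y ^ℚ n))
  {{ℚ.nonNeg*nonNeg⇒nonNeg y {{ℚ.nonNegative 0≤y}} (y ^ℚ n) {{ℚ.nonNegative (^ℚ-nonNeg 0≤y n)}}}}

^ℚ-mono-≤ : ∀ {y z} → 0ℚᵘ ℚ.≤ y → y ℚ.≤ z → ∀ n → y ^ℚ n ℚ.≤ z ^ℚ n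
^ℚ-mono-≤ 0≤y y≤z zero    = ℚ.≤-refl
^ℚ-mono-≤ {y} {z} 0≤y y≤z (suc n) =
  ℚ.*-mono-≤-nonNeg {{ℚ.nonNegative 0≤y}} {{ℚ.nonNegative (^ℚ-nonNeg 0≤y n)}}
    y≤z (^ℚ-mono-≤ 0≤y y≤z n)

½^≤1/ : ∀ n → ½ ^ℚ suc n ℚ.≤ mkℚᵘ (+ 1) n
½^≤1/ zero    = *≤* (ℤ.+≤+ (ℕ.s≤s ℕ.z≤n))
½^≤1/ (suc n) = ℚ.≤-trans (ℚ.*-monoʳ-≤-nonNeg ½ (½^≤1/ n))
  (*≤* (ℤ.+≤+ (ℕ.+-monoˡ-≤ 0 (begin
    suc (suc n)               ≤⟨ ℕ.s≤s (ℕ.m≤n+m (suc n) n) ⟩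
    suc n ℕ.+ suc n           ≡⟨ cong (suc n ℕ.+_) (sym (ℕ.+-identityʳ (suc n))) ⟩
    2 ℕ.* suc n ∎))))
  where open ℕ.≤-Reasoning

≤∣↥∣ : ∀ q → q ℚ.≤ ι ℤ.∣ ↥ q ∣
≤∣↥∣ (mkℚᵘ (+ n) d)    = *≤* (ℤ.*-monoˡ-≤-nonNeg (+ n) (ℤ.+≤+ (ℕ.s≤s ℕ.z≤n)))
≤∣↥∣ (mkℚᵘ -[1+ n ] d) = *≤* ℤ.-≤+

n<2^n : ∀ n → n ℕ.< 2 ℕ.^ n
n<2^n zero    = ℕ.s≤s ℕ.z≤n
n<2^n (suc n) = ℕ.+-mono-≤ (ℕ.m^n>0 2 n) (ℕ.≤-trans (n<2^n n) (ℕ.m≤m+n _ 0))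

2^-cancel-≤ : ∀ {j k} → 2 ℕ.^ j ℕ.≤ 2 ℕ.^ k → j ℕ.≤ k
2^-cancel-≤ 2^j≤2^k = ℕ.≮⇒≥ (λ k<j → ℕ.≤⇒≯ 2^j≤2^k (ℕ.^-monoʳ-< 2 (ℕ.s≤s (ℕ.s≤s ℕ.z≤n)) k<j))

2^≤⇒≤ : ∀ k {n b y} → 0ℚᵘ ℚ.≤ y → y ℚ.≤ ι n →
        2ℚ ^ℚ k ℚ.≤ y ^ℚ b → k ℕ.≤ n ℕ.* b
2^≤⇒≤ k {n} {b} {y} 0≤y y≤n 2^k≤y^b = 2^-cancel-≤ (ι-cancel-≤ (begin
  ι (2 ℕ.^ k)           ≃⟨ ι-^ 2 k ⟨
  2ℚ ^ℚ k               ≤⟨ 2^k≤y^b ⟩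
  y ^ℚ b                ≤⟨ ^ℚ-mono-≤ 0≤y (ℚ.≤-trans y≤n (ι-mono-≤ (ℕ.<⇒≤ (n<2^n n)))) b ⟩
  ι (2 ℕ.^ n) ^ℚ b      ≃⟨ ι-^ (2 ℕ.^ n) b ⟩
  ι ((2 ℕ.^ n) ℕ.^ b)   ≡⟨ cong ι (ℕ.^-*-assoc 2 n b) ⟩
  ι (2 ℕ.^ (n ℕ.* b))   ∎))
  where open ℚ.≤-Reasoning

-- log₂ x is the supremum of the rationals p with 2 ^ p < x.  For
-- p = a/b, the inequality 2 ^ p < x is witnessed by a positive
-- rational y < x with 2 ^ a ≤ y ^ b.
_<log₂_ : ℚᵘ → ℝ → Set
p <log₂ x = ∃[ y ] (lower x y × 0ℚᵘ ℚ.< y × 2^ (↥ p) ℚ.≤ y ^ℚ (↧ₙ p))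

log₂ : (x : ℝ) → Positive x → ℝ
log₂ x 0<x = sup (_<log₂ x) nonempty (ι ℤ.∣ ↥ b ∣ , below)
  where
  b : ℚᵘ
  b = proj₁ (bounded x)

  nonempty : ∃ (_<log₂ x)
  nonempty with open′ x 0<x
  ... | mkℚᵘ (+ zero) d , _ , *<* (ℤ.+<+ ())
  ... | y@(mkℚᵘ (+ suc n) d) , y<x , 0<y =
    mkℚᵘ -[1+ d ] 0 , y , y<x , 0<y , (begin
      ½ ^ℚ suc d          ≤⟨ ½^≤1/ d ⟩
      mkℚᵘ (+ 1) d        ≤⟨ *≤* (ℤ.*-monoʳ-≤-nonNeg (+ suc d) {+ 1} {+ suc n} (ℤ.+≤+ (ℕ.s≤s ℕ.z≤n))) ⟩
      y                   ≃⟨ ℚ.*-identityʳ y ⟨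
      y ^ℚ 1              ∎)
    where open ℚ.≤-Reasoning

  below : ∀ {p} → p <log₂ x → p ℚ.≤ ι ℤ.∣ ↥ b ∣
  below {p@(mkℚᵘ -[1+ _ ] _)} _ = ℚ.≤-trans (ℚ.nonPositive⁻¹ p) (ι-mono-≤ ℕ.z≤n)
  below {mkℚᵘ (+ k) d} (y , y<x , 0<y , 2^k≤y^d) =
    *≤* (subst₂ ℤ._≤_ (sym (ℤ.*-identityʳ (+ k))) (ℤ.pos-* ℤ.∣ ↥ b ∣ (suc d))
      (ℤ.+≤+ (2^≤⇒≤ k {b = suc d} (ℚ.<⇒≤ 0<y) (ℚ.≤-trans (proj₂ (bounded x) y<x) (≤∣↥∣ b)) 2^k≤y^d)))

-- The modulus x ^ m + ∑_{t ∈ T} x ^ t over 𝔽₂ is given by T.  Polynomials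
-- of degree below m are coefficient vectors of length m, and Parity is
-- the field with two elements.

𝔽₂^ : ℕ → Set
𝔽₂^ m = Vector Parity m

∑< : ℕ → (ℕ → ℕ) → ℕ
∑< n f = sum (map f (upTo n))

syntax ∑< n (λ k → a) = ∑[ k < n ] a

module _ {m : ℕ} where

  elements : Subset m → List (Fin m)
  elements T = filter (_∈? T) (allFin m)

  Δ : Fin m → ℕ
  Δ t = m ℕ.∸ toℕ t

  -- The default m is harmless because Δ t ≤ m.
  Δmin : Subset m → ℕ
  Δmin T = min m (map Δ (elements T))

  Δmin-nonZero : .{{_ : NonZero m}} (T : Subset m) → NonZero (Δmin T)
  Δmin-nonZero T = ℕ.>-nonZero (v<min⁺ (ℕ.>-nonZero⁻¹ m)
    (All.map⁺ (All.universal (λ t → ℕ.m<n⇒0<n∸m (toℕ<n t)) (elements T))))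

  -- r = 0 if T ⊆ {0}, and r = ⌈log₂ (m / Δmin)⌉ otherwise.
  IsStageCount : .{{NonZero m}} → Subset m → ℕ → Set
  IsStageCount T r =
    ((∀ t → t ∈ T → toℕ t ≡ 0) → r ≡ 0) ×
    (¬ (∀ t → t ∈ T → toℕ t ≡ 0) →
      IsCeiling (log₂ ((fromℕ m ÷ Δmin T) {{Δmin-nonZero T}})
                      (÷-positive {fromℕ m} (Δmin T) {{Δmin-nonZero T}} (fromℕ-positive m)))
                (+ r))

  N^ : ℕ → 𝔽₂^ m → 𝔽₂^ m
  N^ d y i with toℕ i ℕ.+ d ℕ.<? m
  ... | yes i+d<m = y (fromℕ< i+d<m)
  ... | no  _     = 0ℙ

  U : Subset m → 𝔽₂^ m → 𝔽₂^ m
  U T y i = foldr ℙ._+_ 0ℙ (map (λ t → N^ (Δ t) y i) (elements T))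

  -- A contribution (j , i) adds coefficient j of the source vector to
  -- coefficient i of the destination vector.

  Contribution : Set
  Contribution = Fin m × Fin m

  execute : List Contribution → 𝔽₂^ m → 𝔽₂^ m → 𝔽₂^ m
  execute cs y z = foldr (λ (j , i) z′ → updateAt z′ i (ℙ._+ y j)) z cs

  -- z + N ^ d y: the pairs (i + d , i) with i + d < m.
  shiftContributions : ℕ → List Contribution
  shiftContributions d = mapMaybe
    (λ i → Maybe.map (λ i+d<m → fromℕ< i+d<m , i) (dec⇒maybe (toℕ i ℕ.+ d ℕ.<? m)))
    (allFin m)

  -- z + (x ^ t · y mod x ^ m): the pairs (j , j + t) with j + t < m.
  lowContributions : Fin m → List Contribution
  lowContributions t = mapMaybe
    (λ j → Maybe.map (λ j+t<m → j , fromℕ< j+t<m) (dec⇒maybe (toℕ j ℕ.+ toℕ t ℕ.<? m)))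
    (allFin m)

  -- The set T_k.
  active : Subset m → ℕ → List (Fin m)
  active T k = filter (λ t → 2 ℕ.^ k ℕ.* Δ t ℕ.<? m) (elements T)

  storedShifts : Subset m → ℕ → List (ℕ × Fin m)
  storedShifts T r = concatMap (λ k → map (k ,_) (active T k)) (upTo r)

  stageContributions : Subset m → ℕ → List Contribution
  stageContributions T k = concatMap (λ t → shiftContributions (2 ℕ.^ k ℕ.* Δ t)) (active T k)

  assemblyContributions : Subset m → List Contribution
  assemblyContributions T = concatMap lowContributions (elements T)

  feedback : Subset m → ℕ → 𝔽₂^ m → 𝔽₂^ m
  feedback T zero    y = y
  feedback T (suc r) y = let y′ = feedback T r y in execute (stageContributions T r) y′ y′

  -- The input is L + x ^ m H.
  reduce : Subset m → ℕ → (L H : 𝔽₂^ m) → 𝔽₂^ m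
  reduce T r L H = execute (assemblyContributions T) (feedback T r H) L

  ∑∈ : Subset m → (Fin m → ℕ) → ℕ
  ∑∈ T f = sum (map f (elements T))

  syntax ∑∈ T (λ t → a) = ∑[ t ∈ T ] a

  h : Subset m → ℕ → ℕ
  h T k = length (active T k)

  S-fb : Subset m → ℕ → ℕ
  S-fb T r = length (storedShifts T r)

  W-fb : Subset m → ℕ → ℕ
  W-fb T r = ∑[ k < r ] length (stageContributions T k)

  W-V : Subset m → ℕ
  W-V T = length (assemblyContributions T)

  -- No k ≥ m satisfies 2 ^ k Δ t < m (see inactive), so restricting to
  -- k < m loses nothing in the next two definitions.

  ℓ : Fin m → ℕ
  ℓ t = length (filter (λ k → 2 ℕ.^ k ℕ.* Δ t ℕ.<? m) (upTo m))

  -- ∑_{k ≥ 0} [ m - 2 ^ k Δ t ]₊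
  ∑-positive-parts : Fin m → ℕ
  ∑-positive-parts t = ∑[ k < m ] (m ℕ.∸ 2 ℕ.^ k ℕ.* Δ t)

  inactive : ∀ t {k} → m ℕ.≤ k → m ℕ.≤ 2 ℕ.^ k ℕ.* Δ t
  inactive t {k} m≤k = begin
    m                   ≤⟨ m≤k ⟩
    k                   ≤⟨ ℕ.<⇒≤ (n<2^n k) ⟩
    2 ℕ.^ k             ≤⟨ ℕ.m≤m*n (2 ℕ.^ k) (Δ t) {{ℕ.>-nonZero (ℕ.m<n⇒0<n∸m (toℕ<n t))}} ⟩
    2 ℕ.^ k ℕ.* Δ t     ∎
    where open ℕ.≤-Reasoning

{-# OPTIONS --safe #-}
module Submission where

-- An exponent t takes part in exactly ℓ t stages, and the last of them, if any,
-- shows 2 ^ ℓ t · Δ t < 2 m.  The Δ t are distinct and positive, so their product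
-- is at least s!, and multiplying over T gives 2 ^ S · s! < 2 ^ s · m ^ s, which
-- is the first bound on S.  The second is s ^ s / s! ≤ e ^ s, proved by induction
-- on s from (1 + 1 / n) ^ n ≤ ∑_{k ≤ n} 1 / k!, and e ≤ 3 yields the O-bounds.

open import Defs
open import Algebra.Bundles using (CommutativeRing)
import Algebra.Properties.CommutativeSemiring.Exp as Exp
open import Data.Bool.Base using (if_then_else_)
open import Data.Fin.Base as Fin using (Fin; toℕ)
open import Data.Fin.Properties using (toℕ<n; any?)
open import Data.Fin.Subset using (Subset; ∣_∣; _∈_; inside; outside)
open import Data.Fin.Subset.Properties using (_∈?_; ∣p∣≤n)
open import Data.Integer.Base as ℤ using (+_; -[1+_]; _⊖_)
import Data.Integer.Properties as ℤ
open import Data.List.Base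
  using (List; []; _∷_; map; concatMap; mapMaybe; filter; length; allFin; upTo; tabulate; foldr)
open import Data.List.Extrema.Nat using (min≤xs)
open import Data.List.Membership.Propositional using (lose)
open import Data.List.Membership.Propositional.Properties using (∈-filter⁺; ∈-allFin; ∈-map⁺)
open import Data.List.Properties
  using (map-cong; map-cong-local; map-tabulate; map-applyUpTo; map-upTo; length-map; length-++)
open import Data.List.Relation.Unary.All as All using (All; []; _∷_)
import Data.List.Relation.Unary.All.Properties as All
open import Data.List.Relation.Unary.AllPairs using (AllPairs; []; _∷_)
import Data.List.Relation.Unary.AllPairs.Properties as AllPairs
open import Data.List.Relation.Unary.Any using (Any; here; there)
open import Data.Maybe.Base as Maybe using ()
open import Data.Nat.Base as ℕ
  using (ℕ; zero; suc; NonZero; _+_; _*_; _∸_; _^_; _!; _≤_; _<_; _>_; _⊓_; pred; z≤n; s≤s; s<s; s<s⁻¹; >-nonZero⁻¹)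
open import Data.Nat.ListAction using (sum; product)
open import Data.Nat.Properties as ℕ
open import Data.Nat.Tactic.RingSolver using (solve-∀)
open import Data.Parity.Base as ℙ using (0ℙ)
open import Data.Product.Base using (∃-syntax; _×_; _,_; proj₁; proj₂)
open import Data.Rational.Unnormalised.Base as ℚ
  using (ℚᵘ; mkℚᵘ; 0ℚᵘ; 1ℚᵘ; ½; ↥_; ↧ₙ_; *<*; *≡*)
import Data.Rational.Unnormalised.Properties as ℚ
open import Data.Rational.Unnormalised.Solver using (module +-*-Solver)
open import Data.Vec.Base using (_∷_; [])
open import Function.Base using (_∘_; id)
open import Function.Bundles using (_⇔_; mk⇔)
open import Relation.Binary.PropositionalEquality
  using (_≡_; _≢_; refl; sym; trans; cong; cong₂; subst; subst₂; module ≡-Reasoning)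
open import Relation.Nullary using (Dec; does; yes; no; ¬_; contradiction)
open import Relation.Nullary.Decidable
  using (dec⇒maybe; does-⇔; dec-true; dec-false; _×-dec_; ¬?; decidable-stable)
open import Relation.Unary using (Decidable)

open Exp (CommutativeRing.commutativeSemiring ℚ.+-*-commutativeRing)
  using (^-assocʳ; ^-distrib-*) renaming (^-congˡ to ^ℚ-congˡ)
open +-*-Solver using (solve; con; _:+_; _:*_; _:-_; _:=_)

-- Dedekind cuts

-- A real is given by its lower rationals alone, so a bound a ≤ log₂ x is proved by producing a
-- rational exponent p and a rational y strictly below x with 2 ^ p ≤ y. The counting therefore
-- stays in the natural numbers until each estimate is one integer inequality, and strictness is
-- carried along because cuts are open. The stage count `r` itself arrives as the ceiling of such a
-- logarithm. Before the stages can be counted exponent by exponent, log₂ (m / Δmin) ≤ r has to be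
-- converted into m ≤ 2 ^ r Δmin; then sums over k < r and over k < m agree. Both O-bounds come from
-- one estimate of m (S + s), where the extra m s pays for the assembly. It rests on 2 ^ (S + s) s ^
-- s ≤ (12 m) ^ s, and the constant 5 exceeds log₂ 12 by more than is lost by taking y strictly
-- below m / s.

≤ℝ-trans : ∀ {x y z} → x ≤ℝ y → y ≤ℝ z → x ≤ℝ z
≤ℝ-trans x≤y y≤z q<x = y≤z (x≤y q<x)

-- Openness leaves room above `q`, which upgrades closure under `<` to closure under `≤`. It also
-- transports membership between equivalent unnormalised fractions.
lower-≤ : ∀ x {p q} → p ℚ.≤ q → lower x q → lower x p
lower-≤ x p≤q q<x with open′ x q<x
... | r , r<x , q<r = closed x (ℚ.≤-<-trans p≤q q<r) r<x

fromℚ-< : ∀ {p q} → p ℚ.< q → lower (fromℚ q) p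
fromℚ-< {q = q} p<q = q , refl , p<q

fromℚ-<⁻¹ : ∀ {p q} → lower (fromℚ q) p → p ℚ.< q
fromℚ-<⁻¹ (_ , refl , p<q) = p<q

fromℚ-mono-≤ : ∀ {p q} → p ℚ.≤ q → fromℚ p ≤ℝ fromℚ q
fromℚ-mono-≤ p≤q (_ , refl , r<p) = fromℚ-< (ℚ.<-≤-trans r<p p≤q)

+ℝ-mono-≤ : ∀ {x x′ y y′} → x ≤ℝ x′ → y ≤ℝ y′ → x +ℝ y ≤ℝ x′ +ℝ y′
+ℝ-mono-≤ x≤x′ y≤y′ (p , (a , b , a<x , b<y , p≡a+b) , q<p) =
  p , (a , b , x≤x′ a<x , y≤y′ b<y , p≡a+b) , q<p

·-monoʳ-≤ : ∀ n {x y} → x ≤ℝ y → n · x ≤ℝ n · y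
·-monoʳ-≤ n x≤y (p , (a , a<x , p≡na) , q<p) = p , (a , x≤y a<x , p≡na) , q<p

lower-+ℝ : ∀ x y {a b} → lower x a → lower y b → lower (x +ℝ y) (a ℚ.+ b)
lower-+ℝ x y {a} {b} a<x b<y with open′ x a<x
... | a′ , a′<x , a<a′ =
  a′ ℚ.+ b , (a′ , b , a′<x , b<y , refl) , ℚ.+-monoˡ-< b a<a′

ι*1/ : ∀ n .{{_ : NonZero n}} → ι n ℚ.* (+ 1 ℚ./ n) ℚ.≃ 1ℚᵘ
ι*1/ n@(suc _) = *≡* (trans (ℤ.*-identityʳ _) (cong (λ k → + k) (trans (ℕ.*-identityʳ n) (sym (trans (ℕ.+-identityʳ _) (ℕ.+-identityʳ n))))))

ι-positive : ∀ n .{{_ : NonZero n}} → ℚ.Positive (ι n)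
ι-positive (suc _) = _

1/-positive : ∀ n .{{_ : NonZero n}} → ℚ.Positive (+ 1 ℚ./ n)
1/-positive (suc _) = _

lower-· : ∀ n .{{_ : NonZero n}} x {a} → lower x a → lower (n · x) (ι n ℚ.* a)
lower-· n x {a} a<x with open′ x a<x
... | a′ , a′<x , a<a′ = ι n ℚ.* a′ , (a′ , a′<x , refl) ,
  ℚ.*-monoʳ-<-pos (ι n) {{ι-positive n}} a<a′

ι*[1/*] : ∀ n .{{_ : NonZero n}} a → ι n ℚ.* ((+ 1 ℚ./ n) ℚ.* a) ℚ.≃ a
ι*[1/*] n a = begin
  ι n ℚ.* ((+ 1 ℚ./ n) ℚ.* a)   ≈⟨ ℚ.*-assoc (ι n) (+ 1 ℚ./ n) a ⟨
  ι n ℚ.* (+ 1 ℚ./ n) ℚ.* a     ≈⟨ ℚ.*-congʳ {a} (ι*1/ n) ⟩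
  1ℚᵘ ℚ.* a                     ≈⟨ ℚ.*-identityˡ a ⟩
  a                             ∎
  where open import Relation.Binary.Reasoning.Setoid ℚ.≃-setoid

lower-÷ : ∀ n .{{_ : NonZero n}} x {a} → lower x (ι n ℚ.* a) → lower (x ÷ n) a
lower-÷ n@(suc _) x {a} na<x with open′ x na<x
... | b , b<x , na<b = (+ 1 ℚ./ n) ℚ.* b , (b , b<x , refl) ,
  ℚ.*-cancelˡ-<-nonNeg (ι n) (ℚ.<-respʳ-≃ (ℚ.≃-sym (ι*[1/*] n b)) na<b)

lower-÷⁻¹ : ∀ n .{{_ : NonZero n}} x {a} → lower (x ÷ n) a → lower x (ι n ℚ.* a)
lower-÷⁻¹ n@(suc _) x {a} (_ , (b , b<x , refl) , a<b/n) = lower-≤ x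
  (ℚ.≤-trans (ℚ.*-monoʳ-≤-nonNeg (ι n) (ℚ.<⇒≤ a<b/n)) (ℚ.≤-reflexive (ι*[1/*] n b)))
  b<x

-- Density is used twice: `r` lies between q and a + b, and `u` between r - b and a. Then r - u < b,
-- and the parts `u` and r - u add up to `r`, strictly above q.
fromℚ-+-≤ : ∀ a b → fromℚ (a ℚ.+ b) ≤ℝ fromℚ a +ℝ fromℚ b
fromℚ-+-≤ a b (_ , refl , q<a+b) with ℚ.<-dense q<a+b
... | r , q<r , r<a+b with ℚ.<-dense {r ℚ.- b} {a}
        (ℚ.<-respʳ-≃ (solve 2 (λ a b → a :+ b :- b := a) ℚ.≃-refl a b) (ℚ.+-monoˡ-< (ℚ.- b) r<a+b))
... | u , r-b<u , u<a = u ℚ.+ (r ℚ.- u) ,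
  (u , r ℚ.- u , fromℚ-< u<a , fromℚ-< r-u<b , refl) ,
  ℚ.<-respʳ-≃ (solve 2 (λ r u → r := u :+ (r :- u)) ℚ.≃-refl r u) q<r
  where
  r-u<b : r ℚ.- u ℚ.< b
  r-u<b = ℚ.<-respˡ-≃ (solve 3 (λ r u b → r :- b :+ (b :- u) := r :- u) ℚ.≃-refl r u b)
    (ℚ.<-respʳ-≃ (solve 2 (λ u b → u :+ (b :- u) := b) ℚ.≃-refl u b)
      (ℚ.+-monoˡ-< (b ℚ.- u) r-b<u))

fromℚ-*-≤ : ∀ n .{{_ : NonZero n}} a → fromℚ (ι n ℚ.* a) ≤ℝ n · fromℚ a
fromℚ-*-≤ n@(suc _) a (_ , refl , q<na) with ℚ.<-dense q<na
... | r , q<r , r<na = ι n ℚ.* ((+ 1 ℚ./ n) ℚ.* r) ,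
  ((+ 1 ℚ./ n) ℚ.* r , fromℚ-< (ℚ.*-cancelˡ-<-nonNeg (ι n) (ℚ.<-respˡ-≃ r≃ r<na)) , refl) ,
  ℚ.<-respʳ-≃ r≃ q<r
  where
  r≃ : r ℚ.≃ ι n ℚ.* ((+ 1 ℚ./ n) ℚ.* r)
  r≃ = ℚ.≃-sym (ι*[1/*] n r)

fromℚ≤log₂ : ∀ {p x} (0<x : Positive x) → p <log₂ x → fromℚ p ≤ℝ log₂ x 0<x
fromℚ≤log₂ 0<x p<log₂x (p , refl , q<p) = p , p<log₂x , q<p

-- Rational powers

ι-mono-< : ∀ {m n} → m ℕ.< n → ι m ℚ.< ι n
ι-mono-< m<n = *<* (ℤ.*-monoʳ-<-pos (+ 1) (ℤ.+<+ m<n))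

ι-+ : ∀ m n → ι (m ℕ.+ n) ℚ.≃ ι m ℚ.+ ι n
ι-+ m n = *≡* (cong (ℤ._* + 1) (trans (ℤ.pos-+ m n)
  (sym (cong₂ ℤ._+_ (ℤ.*-identityʳ (+ m)) (ℤ.*-identityʳ (+ n))))))

ι-* : ∀ m n → ι (m ℕ.* n) ℚ.≃ ι m ℚ.* ι n
ι-* m n = *≡* (cong (ℤ._* + 1) (ℤ.pos-* m n))

ι*/ : ∀ i v .{{_ : NonZero v}} → ι v ℚ.* (i ℚ./ v) ℚ.≃ i ℚ./ 1
ι*/ i v@(suc _) = *≡* (trans (ℤ.*-identityʳ _) (trans (ℤ.*-comm (+ v) i)
  (cong (λ k → i ℤ.* + k) (sym (ℕ.+-identityʳ v)))))

ι≃ι+⊖ : ∀ m n → ι m ℚ.≃ ι n ℚ.+ (m ⊖ n) ℚ./ 1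
ι≃ι+⊖ m n = *≡* (cong (ℤ._* + 1) (begin
  + m                             ≡⟨ cong +_ (ℕ.m+n∸m≡n n m) ⟨
  + (n ℕ.+ m ℕ.∸ n)               ≡⟨ ℤ.⊖-≥ (ℕ.m≤m+n n m) ⟨
  n ℕ.+ m ⊖ n                     ≡⟨ ℤ.distribʳ-⊖-+-pos n m n ⟨
  + n ℤ.+ (m ⊖ n)                 ≡⟨ cong₂ ℤ._+_ (ℤ.*-identityʳ (+ n)) (ℤ.*-identityʳ (m ⊖ n)) ⟨
  + n ℤ.* + 1 ℤ.+ (m ⊖ n) ℤ.* + 1 ∎))
  where open ≡-Reasoning

^ℚ-positive : ∀ {y} → ℚ.Positive y → ∀ n → ℚ.Positive (y ^ℚ n)
^ℚ-positive     y>0 zero    = _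
^ℚ-positive {y} y>0 (suc n) = ℚ.pos*pos⇒pos y {{y>0}} (y ^ℚ n) {{^ℚ-positive y>0 n}}

2^-positive : ∀ z → ℚ.Positive (2^ z)
2^-positive (+ n)    = ^ℚ-positive {2ℚ} _ n
2^-positive -[1+ n ] = ^ℚ-positive {½} _ (suc n)

½^*2^ : ∀ n → ½ ^ℚ n ℚ.* 2ℚ ^ℚ n ℚ.≃ 1ℚᵘ
½^*2^ n = ℚ.≃-trans (ℚ.≃-sym (^-distrib-* ½ 2ℚ n)) (go n)
  where
  go : ∀ n → (½ ℚ.* 2ℚ) ^ℚ n ℚ.≃ 1ℚᵘ
  go zero    = ℚ.≃-refl
  go (suc n) = ℚ.*-cong {½ ℚ.* 2ℚ} {1ℚᵘ} (*≡* refl) (go n)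

-- The integer difference allows exponents of either sign; multiplying by the subtracted power
-- removes the case distinction from all later comparisons.
2^⊖*2^ : ∀ a b → 2^ (a ⊖ b) ℚ.* 2ℚ ^ℚ b ℚ.≃ 2ℚ ^ℚ a
2^⊖*2^ a       zero    = ℚ.*-identityʳ (2ℚ ^ℚ a)
2^⊖*2^ zero    (suc b) = ½^*2^ (suc b)
2^⊖*2^ (suc a) (suc b) rewrite ℤ.[1+m]⊖[1+n]≡m⊖n a b = ℚ.≃-trans
  (solve 3 (λ x y z → x :* (z :* y) := z :* (x :* y)) ℚ.≃-refl (2^ (a ⊖ b)) (2ℚ ^ℚ b) 2ℚ)
  (ℚ.*-congˡ {2ℚ} (2^⊖*2^ a b))

-- Multiplying by 2 ^ b and v ^ c clears all denominators. This is how a witness y = u / v for the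
-- exponent (a - b) / c of a logarithm is checked in the natural numbers.
2^⊖≤/^ : ∀ a b c u v .{{_ : NonZero v}} → 2 ℕ.^ a ℕ.* v ℕ.^ c ℕ.≤ 2 ℕ.^ b ℕ.* u ℕ.^ c →
         2^ (a ⊖ b) ℚ.≤ (+ u ℚ./ v) ^ℚ c
2^⊖≤/^ a b c u v 2^a*v^c≤2^b*u^c =
  ℚ.*-cancelʳ-≤-pos (2ℚ ^ℚ b) {{^ℚ-positive {2ℚ} _ b}}
  (ℚ.*-cancelʳ-≤-pos (ι v ^ℚ c) {{^ℚ-positive (ι-positive v) c}} (begin
    2^ (a ⊖ b) ℚ.* 2ℚ ^ℚ b ℚ.* ι v ^ℚ c         ≃⟨ ℚ.*-cong (ℚ.≃-trans (2^⊖*2^ a b) (ι-^ 2 a)) (ι-^ v c) ⟩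
    ι (2 ℕ.^ a) ℚ.* ι (v ℕ.^ c)                 ≃⟨ ι-* (2 ℕ.^ a) (v ℕ.^ c) ⟨
    ι (2 ℕ.^ a ℕ.* v ℕ.^ c)                     ≤⟨ ι-mono-≤ 2^a*v^c≤2^b*u^c ⟩
    ι (2 ℕ.^ b ℕ.* u ℕ.^ c)                     ≃⟨ ι-* (2 ℕ.^ b) (u ℕ.^ c) ⟩
    ι (2 ℕ.^ b) ℚ.* ι (u ℕ.^ c)                 ≃⟨ ℚ.*-cong (ι-^ 2 b) (ι-^ u c) ⟨
    2ℚ ^ℚ b ℚ.* ι u ^ℚ c                        ≃⟨ ℚ.*-congˡ {2ℚ ^ℚ b} (ℚ.≃-trans (ℚ.≃-sym
                                                     (^-distrib-* (ι v) w c)) (^ℚ-congˡ c (ι*/ (+ u) v))) ⟨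
    2ℚ ^ℚ b ℚ.* (ι v ^ℚ c ℚ.* w ^ℚ c)           ≃⟨ solve 3 (λ x y z → x :* (y :* z) := z :* x :* y)
                                                     ℚ.≃-refl (2ℚ ^ℚ b) (ι v ^ℚ c) (w ^ℚ c) ⟩
    w ^ℚ c ℚ.* 2ℚ ^ℚ b ℚ.* ι v ^ℚ c             ∎))
  where
  open ℚ.≤-Reasoning
  w : ℚᵘ
  w = + u ℚ./ v

*-nonNeg : ∀ {a b} → 0ℚᵘ ℚ.≤ a → 0ℚᵘ ℚ.≤ b → 0ℚᵘ ℚ.≤ a ℚ.* b
*-nonNeg {a} {b} 0≤a 0≤b = ℚ.nonNegative⁻¹ (a ℚ.* b)
  {{ℚ.nonNeg*nonNeg⇒nonNeg a {{ℚ.nonNegative 0≤a}} b {{ℚ.nonNegative 0≤b}}}}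

-- Homogeneous Bernoulli inequality: the left side consists of the first two terms of the binomial
-- expansion.
tangent-≤ : ∀ {x y} → 0ℚᵘ ℚ.≤ x → 0ℚᵘ ℚ.≤ y → ∀ k →
            y ^ℚ suc k ℚ.+ ι (suc k) ℚ.* (x ℚ.* y ^ℚ k) ℚ.≤ (y ℚ.+ x) ^ℚ suc k
tangent-≤ {x} {y} 0≤x 0≤y zero = ℚ.≤-reflexive
  (solve 2 (λ x y → y :* con 1ℚᵘ :+ con 1ℚᵘ :* (x :* con 1ℚᵘ) := (y :+ x) :* con 1ℚᵘ) ℚ.≃-refl x y)
tangent-≤ {x} {y} 0≤x 0≤y (suc k) = begin
  y ^ℚ suc (suc k) ℚ.+ ι (suc (suc k)) ℚ.* (x ℚ.* y ^ℚ suc k)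
    ≃⟨ ℚ.+-congʳ (y ^ℚ suc (suc k)) (ℚ.*-congʳ {x ℚ.* y ^ℚ suc k} (ι-+ 1 (suc k))) ⟩
  y ^ℚ suc (suc k) ℚ.+ (1ℚᵘ ℚ.+ ι (suc k)) ℚ.* (x ℚ.* y ^ℚ suc k)
    -- The added term (k + 1) x ^ 2 y ^ k is exactly what completes the sum to a multiple of y + x.
    ≤⟨ ℚ.p≤p+q _ _ {{ℚ.nonNegative 0≤ixx}} ⟩
  y ^ℚ suc (suc k) ℚ.+ (1ℚᵘ ℚ.+ ι (suc k)) ℚ.* (x ℚ.* y ^ℚ suc k) ℚ.+ ι (suc k) ℚ.* (x ℚ.* x ℚ.* y ^ℚ k)
    ≃⟨ solve 4 (λ x y i w → y :* (y :* w) :+ (con 1ℚᵘ :+ i) :* (x :* (y :* w)) :+ i :* (x :* x :* w)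
                 := (y :+ x) :* (y :* w :+ i :* (x :* w))) ℚ.≃-refl x y (ι (suc k)) (y ^ℚ k) ⟩
  (y ℚ.+ x) ℚ.* (y ^ℚ suc k ℚ.+ ι (suc k) ℚ.* (x ℚ.* y ^ℚ k))
    ≤⟨ ℚ.*-monoʳ-≤-nonNeg (y ℚ.+ x) {{ℚ.nonNegative (ℚ.+-mono-≤ 0≤y 0≤x)}} (tangent-≤ 0≤x 0≤y k) ⟩
  (y ℚ.+ x) ^ℚ suc (suc k) ∎
  where
  open ℚ.≤-Reasoning
  0≤ixx : 0ℚᵘ ℚ.≤ ι (suc k) ℚ.* (x ℚ.* x ℚ.* y ^ℚ k)
  0≤ixx = *-nonNeg (ι-mono-≤ {0} {suc k} ℕ.z≤n) (*-nonNeg (*-nonNeg 0≤x 0≤x) (^ℚ-nonNeg 0≤y k))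

-- Partial sums of the exponential series

1/!-suc : ∀ n → 1/! suc n ℚ.* ι (suc n) ℚ.≃ 1/! n
1/!-suc n = go (suc n) (n !) {{suc n ℕ.!≢0}} {{n ℕ.!≢0}}
  where
  regroup : ∀ a b → (a ℕ.+ 0) ℕ.* b ≡ a ℕ.* b ℕ.* 1 ℕ.+ 0
  regroup = solve-∀
  go : ∀ a b .{{_ : NonZero (a ℕ.* b)}} .{{_ : NonZero b}} .{{_ : NonZero a}} →
       (+ 1 ℚ./ (a ℕ.* b)) ℚ.* ι a ℚ.≃ + 1 ℚ./ b
  go a@(suc _) b@(suc _) = *≡* (cong +_ (regroup a b))

1/!-positive : ∀ n → ℚ.Positive (1/! n)
1/!-positive n = 1/-positive (n !) {{n ℕ.!≢0}}

-- The argument is kept free because the induction in `[1+x]^n≤exp` moves it from n x to (n + 1) x;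
-- only afterwards is n x specialised to 1.
exp-partial : ℕ → ℚᵘ → ℚᵘ
exp-partial zero    x = 1/! 0
exp-partial (suc n) x = exp-partial n x ℚ.+ 1/! suc n ℚ.* x ^ℚ suc n

exp-partial-cong : ∀ n {x y} → x ℚ.≃ y → exp-partial n x ℚ.≃ exp-partial n y
exp-partial-cong zero    x≃y = ℚ.≃-refl
exp-partial-cong (suc n) x≃y =
  ℚ.+-cong (exp-partial-cong n x≃y) (ℚ.*-congˡ {1/! suc n} (^ℚ-congˡ (suc n) x≃y))

exp-partial-1 : ∀ n → exp-partial n 1ℚᵘ ℚ.≃ e-partial n
exp-partial-1 zero    = ℚ.≃-refl
exp-partial-1 (suc n) = ℚ.+-cong (exp-partial-1 n)
  (ℚ.≃-trans (ℚ.*-congˡ {1/! suc n} (1^ (suc n))) (ℚ.*-identityʳ (1/! suc n)))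
  where
  1^ : ∀ n → 1ℚᵘ ^ℚ n ℚ.≃ 1ℚᵘ
  1^ zero    = ℚ.≃-refl
  1^ (suc n) = ℚ.≃-trans (ℚ.*-identityˡ (1ℚᵘ ^ℚ n)) (1^ n)

exp-partial-suc-≤ : ∀ n {x} → 0ℚᵘ ℚ.≤ x → exp-partial n x ℚ.≤ exp-partial (suc n) x
exp-partial-suc-≤ n {x} 0≤x = ℚ.p≤p+q (exp-partial n x) (1/! suc n ℚ.* x ^ℚ suc n)
  {{ℚ.nonNegative (*-nonNeg (1/!-nonNeg (suc n)) (^ℚ-nonNeg 0≤x (suc n)))}}

-- This is `tangent-≤` divided by (n + 1)!. Since (n + 1) / (n + 1)! = 1 / n!, its linear term
-- becomes `x` times the preceding term of the series.
term-step : ∀ n {x y} → 0ℚᵘ ℚ.≤ x → 0ℚᵘ ℚ.≤ y →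
            1/! suc n ℚ.* y ^ℚ suc n ℚ.+ x ℚ.* (1/! n ℚ.* y ^ℚ n) ℚ.≤
            1/! suc n ℚ.* (y ℚ.+ x) ^ℚ suc n
term-step n {x} {y} 0≤x 0≤y = begin
  1/! suc n ℚ.* y ^ℚ suc n ℚ.+ x ℚ.* (1/! n ℚ.* y ^ℚ n)
    ≃⟨ ℚ.+-congʳ (1/! suc n ℚ.* y ^ℚ suc n)
         (ℚ.*-congˡ {x} (ℚ.*-congʳ {y ^ℚ n} (1/!-suc n))) ⟨
  1/! suc n ℚ.* y ^ℚ suc n ℚ.+ x ℚ.* (1/! suc n ℚ.* ι (suc n) ℚ.* y ^ℚ n)
    ≃⟨ solve 5 (λ f i x v w → f :* v :+ x :* (f :* i :* w) := f :* (v :+ i :* (x :* w)))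
         ℚ.≃-refl (1/! suc n) (ι (suc n)) x (y ^ℚ suc n) (y ^ℚ n) ⟩
  1/! suc n ℚ.* (y ^ℚ suc n ℚ.+ ι (suc n) ℚ.* (x ℚ.* y ^ℚ n))
    ≤⟨ ℚ.*-monoʳ-≤-nonNeg (1/! suc n) {{ℚ.nonNegative (1/!-nonNeg (suc n))}} (tangent-≤ 0≤x 0≤y n) ⟩
  1/! suc n ℚ.* (y ℚ.+ x) ^ℚ suc n ∎
  where open ℚ.≤-Reasoning

-- The polynomial of degree n is the derivative of the one of degree n + 1, so this is the
-- tangent-line bound at `y`, obtained by adding up `term-step`.
exp-partial-step : ∀ n {x y} → 0ℚᵘ ℚ.≤ x → 0ℚᵘ ℚ.≤ y →
                   exp-partial (suc n) y ℚ.+ x ℚ.* exp-partial n y ℚ.≤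
                   exp-partial (suc n) (y ℚ.+ x)
exp-partial-step zero {x} {y} 0≤x 0≤y = begin
  1/! 0 ℚ.+ 1/! 1 ℚ.* y ^ℚ 1 ℚ.+ x ℚ.* 1/! 0
    ≃⟨ solve 4 (λ x a b f → a :+ b :+ x :* f := a :+ (b :+ x :* (f :* con 1ℚᵘ))) ℚ.≃-refl
         x (1/! 0) (1/! 1 ℚ.* y ^ℚ 1) (1/! 0) ⟩
  1/! 0 ℚ.+ (1/! 1 ℚ.* y ^ℚ 1 ℚ.+ x ℚ.* (1/! 0 ℚ.* y ^ℚ 0))
    ≤⟨ ℚ.+-monoʳ-≤ (1/! 0) (term-step 0 0≤x 0≤y) ⟩
  1/! 0 ℚ.+ 1/! 1 ℚ.* (y ℚ.+ x) ^ℚ 1 ∎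
  where open ℚ.≤-Reasoning
exp-partial-step (suc n) {x} {y} 0≤x 0≤y = begin
  A ℚ.+ b ℚ.+ x ℚ.* (C ℚ.+ d)
    ≃⟨ solve 5 (λ A b x C d → A :+ b :+ x :* (C :+ d) := (A :+ x :* C) :+ (b :+ x :* d)) ℚ.≃-refl A b x C d ⟩
  (A ℚ.+ x ℚ.* C) ℚ.+ (b ℚ.+ x ℚ.* d)
    ≤⟨ ℚ.+-mono-≤ (exp-partial-step n 0≤x 0≤y) (term-step (suc n) 0≤x 0≤y) ⟩
  exp-partial (suc (suc n)) (y ℚ.+ x) ∎
  where
  open ℚ.≤-Reasoning
  A b C d : ℚᵘ
  A = exp-partial (suc n) y
  b = 1/! suc (suc n) ℚ.* y ^ℚ suc (suc n)
  C = exp-partial n y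
  d = 1/! suc n ℚ.* y ^ℚ suc n

-- No binomial expansion is needed: a new factor 1 + x is absorbed by raising the degree by one and
-- moving the argument by `x`.
[1+x]^n≤exp : ∀ n {x} → 0ℚᵘ ℚ.≤ x → (1ℚᵘ ℚ.+ x) ^ℚ n ℚ.≤ exp-partial n (ι n ℚ.* x)
[1+x]^n≤exp zero    0≤x = ℚ.≤-refl
[1+x]^n≤exp (suc n) {x} 0≤x = begin
  (1ℚᵘ ℚ.+ x) ℚ.* (1ℚᵘ ℚ.+ x) ^ℚ n
    ≤⟨ ℚ.*-monoʳ-≤-nonNeg (1ℚᵘ ℚ.+ x) {{ℚ.nonNegative (ℚ.+-mono-≤ {0ℚᵘ} {1ℚᵘ} {0ℚᵘ} (ι-mono-≤ {0} {1} ℕ.z≤n) 0≤x)}} ([1+x]^n≤exp n 0≤x) ⟩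
  (1ℚᵘ ℚ.+ x) ℚ.* E
    ≃⟨ solve 2 (λ x E → (con 1ℚᵘ :+ x) :* E := E :+ x :* E) ℚ.≃-refl x E ⟩
  E ℚ.+ x ℚ.* E
    ≤⟨ ℚ.+-monoˡ-≤ (x ℚ.* E) (exp-partial-suc-≤ n 0≤nx) ⟩
  exp-partial (suc n) (ι n ℚ.* x) ℚ.+ x ℚ.* E
    ≤⟨ exp-partial-step n 0≤x 0≤nx ⟩
  exp-partial (suc n) (ι n ℚ.* x ℚ.+ x)
    ≃⟨ exp-partial-cong (suc n) (begin-equality
         ι n ℚ.* x ℚ.+ x           ≃⟨ solve 2 (λ i x → i :* x :+ x := (con 1ℚᵘ :+ i) :* x) ℚ.≃-refl (ι n) x ⟩
         (1ℚᵘ ℚ.+ ι n) ℚ.* x       ≃⟨ ℚ.*-congʳ {x} (ι-+ 1 n) ⟨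
         ι (suc n) ℚ.* x           ∎) ⟩
  exp-partial (suc n) (ι (suc n) ℚ.* x) ∎
  where
  open ℚ.≤-Reasoning
  E : ℚᵘ
  E = exp-partial n (ι n ℚ.* x)
  0≤nx : 0ℚᵘ ℚ.≤ ι n ℚ.* x
  0≤nx = *-nonNeg (ι-mono-≤ {0} {n} ℕ.z≤n) 0≤x

[1+n]^n≤n^n*e : ∀ n → ι (suc n) ^ℚ n ℚ.≤ ι n ^ℚ n ℚ.* e-partial n
[1+n]^n≤n^n*e zero        = ℚ.≤-refl
[1+n]^n≤n^n*e n@(suc _) = begin
  ι (suc n) ^ℚ n                        ≃⟨ ^ℚ-congˡ n (begin-equality
    ι (1 ℕ.+ n)                           ≃⟨ ι-+ 1 n ⟩
    1ℚᵘ ℚ.+ ι n                           ≃⟨ ℚ.+-congˡ (ι n) (ι*1/ n) ⟨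
    ι n ℚ.* x ℚ.+ ι n                     ≃⟨ solve 2 (λ i x → i :* x :+ i := i :* (con 1ℚᵘ :+ x)) ℚ.≃-refl (ι n) x ⟩
    ι n ℚ.* (1ℚᵘ ℚ.+ x)                   ∎) ⟩
  (ι n ℚ.* (1ℚᵘ ℚ.+ x)) ^ℚ n            ≃⟨ ^-distrib-* (ι n) (1ℚᵘ ℚ.+ x) n ⟩
  ι n ^ℚ n ℚ.* (1ℚᵘ ℚ.+ x) ^ℚ n         ≤⟨ ℚ.*-monoʳ-≤-nonNeg (ι n ^ℚ n) {{n^n}} ([1+x]^n≤exp n (ℚ.nonNegative⁻¹ x)) ⟩
  ι n ^ℚ n ℚ.* exp-partial n (ι n ℚ.* x) ≃⟨ ℚ.*-congˡ {ι n ^ℚ n} (exp-partial-cong n (ι*1/ n)) ⟩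
  ι n ^ℚ n ℚ.* exp-partial n 1ℚᵘ         ≃⟨ ℚ.*-congˡ {ι n ^ℚ n} (exp-partial-1 n) ⟩
  ι n ^ℚ n ℚ.* e-partial n               ∎
  where
  open ℚ.≤-Reasoning
  x : ℚᵘ
  x = + 1 ℚ./ n
  n^n : ℚ.NonNegative (ι n ^ℚ n)
  n^n = ℚ.nonNegative (^ℚ-nonNeg (ι-mono-≤ {0} {n} ℕ.z≤n) n)

e-partial-nonNeg : ∀ n → 0ℚᵘ ℚ.≤ e-partial n
e-partial-nonNeg zero    = 1/!-nonNeg 0
e-partial-nonNeg (suc n) = ℚ.+-mono-≤ {0ℚᵘ} {e-partial n} (e-partial-nonNeg n) (1/!-nonNeg (suc n))

e-partial-suc-< : ∀ n → e-partial n ℚ.< e-partial (suc n)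
e-partial-suc-< n = ℚ.<-respˡ-≃ (ℚ.+-identityʳ (e-partial n))
  (ℚ.+-monoʳ-< (e-partial n) (ℚ.positive⁻¹ (1/! suc n) {{1/!-positive (suc n)}}))

-- Since one factor n + 1 cancels against (n + 1)!, the left side grows from n ≥ 1 to n + 1 by the
-- factor (1 + 1 / n) ^ n, which is at most the partial sum. Using partial sums in place of e keeps
-- the estimate rational; the index is raised in the last step.
n^n/n!≤e^n : ∀ n → ι n ^ℚ n ℚ.* 1/! n ℚ.≤ e-partial n ^ℚ n
n^n/n!≤e^n zero    = ℚ.≤-refl
n^n/n!≤e^n (suc n) = begin
  ι (suc n) ^ℚ suc n ℚ.* 1/! suc n
    ≃⟨ solve 3 (λ i v f → i :* v :* f := v :* (f :* i)) ℚ.≃-refl (ι (suc n)) (ι (suc n) ^ℚ n) (1/! suc n) ⟩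
  ι (suc n) ^ℚ n ℚ.* (1/! suc n ℚ.* ι (suc n))
    ≃⟨ ℚ.*-congˡ {ι (suc n) ^ℚ n} (1/!-suc n) ⟩
  ι (suc n) ^ℚ n ℚ.* 1/! n
    ≤⟨ ℚ.*-monoˡ-≤-nonNeg (1/! n) {{ℚ.nonNegative (1/!-nonNeg n)}} ([1+n]^n≤n^n*e n) ⟩
  ι n ^ℚ n ℚ.* e-partial n ℚ.* 1/! n
    ≃⟨ solve 3 (λ v g f → v :* g :* f := g :* (v :* f)) ℚ.≃-refl (ι n ^ℚ n) (e-partial n) (1/! n) ⟩
  e-partial n ℚ.* (ι n ^ℚ n ℚ.* 1/! n)
    ≤⟨ ℚ.*-monoʳ-≤-nonNeg (e-partial n) {{ℚ.nonNegative (e-partial-nonNeg n)}} (n^n/n!≤e^n n) ⟩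
  e-partial n ^ℚ suc n
    ≤⟨ ^ℚ-mono-≤ (e-partial-nonNeg n) (ℚ.<⇒≤ (e-partial-suc-< n)) (suc n) ⟩
  e-partial (suc n) ^ℚ suc n ∎
  where open ℚ.≤-Reasoning

n^n≤n!*3^n : ∀ n → n ℕ.^ n ℕ.≤ n ! ℕ.* 3 ℕ.^ n
n^n≤n!*3^n n = ι-cancel-≤ (begin
  ι (n ℕ.^ n)                        ≃⟨ ι-^ n n ⟨
  ι n ^ℚ n                           ≃⟨ ι*[1/*] (n !) {{n ℕ.!≢0}} (ι n ^ℚ n) ⟨
  ι (n !) ℚ.* (1/! n ℚ.* ι n ^ℚ n)   ≤⟨ ℚ.*-monoʳ-≤-nonNeg (ι (n !)) (begin
    1/! n ℚ.* ι n ^ℚ n                 ≃⟨ ℚ.*-comm (1/! n) (ι n ^ℚ n) ⟩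
    ι n ^ℚ n ℚ.* 1/! n                 ≤⟨ n^n/n!≤e^n n ⟩
    e-partial n ^ℚ n                   ≤⟨ ^ℚ-mono-≤ (e-partial-nonNeg n) (e-partial≤3 n) n ⟩
    ι 3 ^ℚ n                           ≃⟨ ι-^ 3 n ⟩
    ι (3 ℕ.^ n)                        ∎) ⟩
  ι (n !) ℚ.* ι (3 ℕ.^ n)            ≃⟨ ι-* (n !) (3 ℕ.^ n) ⟨
  ι (n ! ℕ.* 3 ℕ.^ n)                ∎)
  where open ℚ.≤-Reasoning

e-partial-positive : ∀ n → ℚ.Positive (e-partial n)
e-partial-positive zero    = 1/!-positive 0
e-partial-positive (suc n) = ℚ.positive (ℚ.≤-<-trans (e-partial-nonNeg n) (e-partial-suc-< n))

-- Estimates of logarithms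

fromℕ≤s+log₂ : ∀ S s M f .{{_ : NonZero f}} (0<x : Positive (fromℕ M ÷ f)) →
               2 ℕ.^ S ℕ.* f ℕ.< 2 ℕ.^ s ℕ.* M →
               fromℕ S ≤ℝ fromℕ s +ℝ log₂ (fromℕ M ÷ f) 0<x
fromℕ≤s+log₂ S s M f 0<x 2^Sf<2^sM =
  ≤ℝ-trans {fromℕ S} {fromℚ (ι s ℚ.+ p)} {z} (fromℚ-mono-≤ (ℚ.≤-reflexive (ι≃ι+⊖ S s)))
  (≤ℝ-trans {fromℚ (ι s ℚ.+ p)} {fromℕ s +ℝ fromℚ p} {z} (fromℚ-+-≤ (ι s) p)
    (+ℝ-mono-≤ {fromℕ s} {fromℕ s} {fromℚ p} {log₂ x 0<x} (λ q → q) (fromℚ≤log₂ {p} {x} 0<x p<log₂x)))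
  where
  open ℚ.≤-Reasoning
  x z : ℝ
  x = fromℕ M ÷ f
  z = fromℕ s +ℝ log₂ x 0<x
  p : ℚᵘ
  p = (S ⊖ s) ℚ./ 1
  f2^p<M : ι f ℚ.* 2^ (S ⊖ s) ℚ.< ι M
  f2^p<M = ℚ.*-cancelʳ-<-nonNeg (2ℚ ^ℚ s) {{ℚ.pos⇒nonNeg (2ℚ ^ℚ s) {{^ℚ-positive {2ℚ} _ s}}}} (begin-strict
    ι f ℚ.* 2^ (S ⊖ s) ℚ.* 2ℚ ^ℚ s     ≃⟨ ℚ.*-assoc (ι f) (2^ (S ⊖ s)) (2ℚ ^ℚ s) ⟩
    ι f ℚ.* (2^ (S ⊖ s) ℚ.* 2ℚ ^ℚ s)   ≃⟨ ℚ.*-congˡ {ι f} (ℚ.≃-trans (2^⊖*2^ S s) (ι-^ 2 S)) ⟩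
    ι f ℚ.* ι (2 ℕ.^ S)                ≃⟨ ℚ.*-comm (ι f) (ι (2 ℕ.^ S)) ⟩
    ι (2 ℕ.^ S) ℚ.* ι f                ≃⟨ ι-* (2 ℕ.^ S) f ⟨
    ι (2 ℕ.^ S ℕ.* f)                  <⟨ ι-mono-< 2^Sf<2^sM ⟩
    ι (2 ℕ.^ s ℕ.* M)                  ≃⟨ ι-* (2 ℕ.^ s) M ⟩
    ι (2 ℕ.^ s) ℚ.* ι M                ≃⟨ ℚ.*-comm (ι (2 ℕ.^ s)) (ι M) ⟩
    ι M ℚ.* ι (2 ℕ.^ s)                ≃⟨ ℚ.*-congˡ {ι M} (ι-^ 2 s) ⟨
    ι M ℚ.* 2ℚ ^ℚ s                    ∎)
  p<log₂x : p <log₂ x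
  -- The power 2 ^ (S - s) is its own witness. It belongs to the open class of M / f because the
  -- assumed integer inequality is strict.
  p<log₂x = 2^ (S ⊖ s) , lower-÷ f (fromℕ M) (fromℚ-< f2^p<M) ,
    ℚ.positive⁻¹ (2^ (S ⊖ s)) {{2^-positive (S ⊖ s)}} ,
    ℚ.≤-reflexive (ℚ.≃-sym (ℚ.*-identityʳ (2^ (S ⊖ s))))

-- Already the partial sum eₛ of e satisfies s ^ s / s! ≤ eₛ ^ s, so y′ = m eₛ / s
-- lies strictly below e m / s and no limit has to be taken.
log₂-m^s/s!≤ : ∀ m s .{{_ : NonZero m}} .{{_ : NonZero s}} .{{s!≢0 : NonZero (s !)}}
  (0<x : Positive (fromℕ (m ℕ.^ s) ÷ (s !))) (0<y : Positive ((m · e) ÷ s)) →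
  fromℕ s +ℝ log₂ (fromℕ (m ℕ.^ s) ÷ (s !)) 0<x ≤ℝ s · (fromℕ 1 +ℝ log₂ ((m · e) ÷ s) 0<y)
log₂-m^s/s!≤ m s@(suc _) 0<x 0<y {q}
  (_ , (a , b , a<s , (p@(mkℚᵘ n d) , (y , y<x , 0<v , 2^n≤y^d) , b<p) , refl) , q<a+b) =
  lower-≤ (s · (fromℕ 1 +ℝ L)) (begin
      q                              ≤⟨ ℚ.<⇒≤ q<a+b ⟩
      a ℚ.+ b                        ≃⟨ ℚ.+-cong (ι*[1/*] s a) (ι*[1/*] s b) ⟨
      ι s ℚ.* (c ℚ.* a) ℚ.+ ι s ℚ.* (c ℚ.* b) ≃⟨ ℚ.*-distribˡ-+ (ι s) (c ℚ.* a) (c ℚ.* b) ⟨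
      ι s ℚ.* (c ℚ.* a ℚ.+ c ℚ.* b)  ∎)
    (lower-· s (fromℕ 1 +ℝ L) (lower-+ℝ (fromℕ 1) L (fromℚ-< a/s<1)
      (c ℚ.* p , (y′ , y′<em/s , ℚ.positive⁻¹ y′ {{0<y′}} , 2^≤y′^) , ℚ.*-monoʳ-<-pos c b<p)))
  where
  open ℚ.≤-Reasoning
  L : ℝ
  L = log₂ ((m · e) ÷ s) 0<y
  c eₛ y′ : ℚᵘ
  c  = + 1 ℚ./ s
  eₛ = e-partial s
  y′ = c ℚ.* (ι m ℚ.* eₛ)
  0<y′ : ℚ.Positive y′
  0<y′ = ℚ.pos*pos⇒pos c (ι m ℚ.* eₛ) {{ℚ.pos*pos⇒pos (ι m) {{ι-positive m}} eₛ
    {{e-partial-positive s}}}}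
  a/s<1 : c ℚ.* a ℚ.< ι 1
  a/s<1 = ℚ.*-cancelˡ-<-nonNeg (ι s) (begin-strict
    ι s ℚ.* (c ℚ.* a)   ≃⟨ ι*[1/*] s a ⟩
    a                   <⟨ fromℚ-<⁻¹ a<s ⟩
    ι s                 ≃⟨ ℚ.*-identityʳ (ι s) ⟨
    ι s ℚ.* ι 1         ∎)
  y′<em/s : lower ((m · e) ÷ s) y′
  y′<em/s = lower-÷ s (m · e) (lower-≤ (m · e) (ℚ.≤-reflexive (ι*[1/*] s (ι m ℚ.* eₛ)))
    (lower-· m e (e-partial (suc s) , (suc s , refl) , e-partial-suc-< s)))
  s!y≤m^s : ι (s !) ℚ.* y ℚ.≤ ι m ^ℚ s
  s!y≤m^s = ℚ.≤-trans
    (ℚ.<⇒≤ (fromℚ-<⁻¹ (lower-÷⁻¹ (s !) (fromℕ (m ℕ.^ s)) y<x)))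
    (ℚ.≤-reflexive (ℚ.≃-sym (ι-^ m s)))
  y≤y′^s : y ℚ.≤ y′ ^ℚ s
  -- With the factor s ^ s restored, the claim splits into s! y ≤ m ^ s and s ^ s / s! ≤ eₛ ^ s.
  y≤y′^s = ℚ.*-cancelˡ-≤-pos (ι s ^ℚ s) {{^ℚ-positive {ι s} (ι-positive s) s}} (begin
    ι s ^ℚ s ℚ.* y
      ≃⟨ ℚ.*-congˡ {ι s ^ℚ s} (ι*[1/*] (s !) {{s ℕ.!≢0}} y) ⟨
    ι s ^ℚ s ℚ.* (ι (s !) ℚ.* (1/! s ℚ.* y))
      ≃⟨ solve 4 (λ v f g y → v :* (f :* (g :* y)) := v :* g :* (f :* y)) ℚ.≃-refl (ι s ^ℚ s) (ι (s !)) (1/! s) y ⟩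
    ι s ^ℚ s ℚ.* 1/! s ℚ.* (ι (s !) ℚ.* y)
      ≤⟨ ℚ.*-monoʳ-≤-nonNeg (ι s ^ℚ s ℚ.* 1/! s) {{ℚ.nonNegative (*-nonNeg (^ℚ-nonNeg (ι-mono-≤ {0} {s} ℕ.z≤n) s) (1/!-nonNeg s))}} s!y≤m^s ⟩
    ι s ^ℚ s ℚ.* 1/! s ℚ.* ι m ^ℚ s
      ≤⟨ ℚ.*-monoˡ-≤-nonNeg (ι m ^ℚ s) {{ℚ.nonNegative (^ℚ-nonNeg (ι-mono-≤ {0} {m} ℕ.z≤n) s)}} (n^n/n!≤e^n s) ⟩
    eₛ ^ℚ s ℚ.* ι m ^ℚ s
      ≃⟨ ℚ.*-comm (eₛ ^ℚ s) (ι m ^ℚ s) ⟩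
    ι m ^ℚ s ℚ.* eₛ ^ℚ s
      ≃⟨ ^-distrib-* (ι m) eₛ s ⟨
    (ι m ℚ.* eₛ) ^ℚ s
      ≃⟨ ^ℚ-congˡ s (ι*[1/*] s (ι m ℚ.* eₛ)) ⟨
    (ι s ℚ.* y′) ^ℚ s
      ≃⟨ ^-distrib-* (ι s) y′ s ⟩
    ι s ^ℚ s ℚ.* y′ ^ℚ s ∎)
  2^≤y′^ : 2^ (↥ (c ℚ.* p)) ℚ.≤ y′ ^ℚ (↧ₙ (c ℚ.* p))
  -- Products of fractions are not reduced: `c ℚ.* p` keeps the numerator n and has denominator s (d
  -- + 1), so y ≤ y′ ^ s only has to be raised to the power d + 1.
  2^≤y′^ = begin
    2^ (+ 1 ℤ.* n)            ≡⟨ cong 2^_ (ℤ.*-identityˡ n) ⟩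
    2^ n                      ≤⟨ 2^n≤y^d ⟩
    y ^ℚ suc d                ≤⟨ ^ℚ-mono-≤ (ℚ.<⇒≤ 0<v) y≤y′^s (suc d) ⟩
    (y′ ^ℚ s) ^ℚ suc d        ≃⟨ ^-assocʳ y′ s (suc d) ⟩
    y′ ^ℚ (s ℕ.* suc d)       ∎

^ℕ-distrib-* : ∀ o m n → (m ℕ.* n) ℕ.^ o ≡ m ℕ.^ o ℕ.* n ℕ.^ o
^ℕ-distrib-* zero    m n = refl
^ℕ-distrib-* (suc o) m n = trans (cong (m ℕ.* n ℕ.*_) (^ℕ-distrib-* o m n))
  (ℕ.[m*n]*[o*p]≡[m*o]*[n*p] m n (m ℕ.^ o) (n ℕ.^ o))

-- Below the common s-th power, 12 m v ^ 5 s ^ 4 is compared with (2 u m) ^ 5. The constants are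
-- covered by 12 v ^ 5 ≤ (2 u) ^ 5, and s ^ 4 ≤ m ^ 4 expresses that log₂ (m / s) is not negative.
scale-≤ : ∀ u v m s K → s ℕ.≤ m → 12 ℕ.* v ℕ.^ 5 ℕ.≤ (2 ℕ.* u) ℕ.^ 5 →
          2 ℕ.^ K ℕ.* s ℕ.^ s ℕ.≤ (12 ℕ.* m) ℕ.^ s →
          2 ℕ.^ K ℕ.* (v ℕ.* s) ℕ.^ (5 ℕ.* s) ℕ.≤ 2 ℕ.^ (5 ℕ.* s) ℕ.* (u ℕ.* m) ℕ.^ (5 ℕ.* s)
scale-≤ u v m s K s≤m 12v^5≤ 2^Ks^s≤ = begin
  2 ℕ.^ K ℕ.* (v ℕ.* s) ℕ.^ (5 ℕ.* s)                ≡⟨ cong (2 ℕ.^ K ℕ.*_) (ℕ.^-*-assoc (v ℕ.* s) 5 s) ⟨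
  2 ℕ.^ K ℕ.* ((v ℕ.* s) ℕ.^ 5) ℕ.^ s                ≡⟨ cong (λ k → 2 ℕ.^ K ℕ.* k ℕ.^ s) (trans (^ℕ-distrib-* 5 v s) (swap (v ℕ.^ 5) s (s ℕ.^ 4))) ⟩
  2 ℕ.^ K ℕ.* (s ℕ.* (v ℕ.^ 5 ℕ.* s ℕ.^ 4)) ℕ.^ s    ≡⟨ cong (2 ℕ.^ K ℕ.*_) (^ℕ-distrib-* s s (v ℕ.^ 5 ℕ.* s ℕ.^ 4)) ⟩
  2 ℕ.^ K ℕ.* (s ℕ.^ s ℕ.* W)                        ≡⟨ ℕ.*-assoc (2 ℕ.^ K) (s ℕ.^ s) W ⟨
  2 ℕ.^ K ℕ.* s ℕ.^ s ℕ.* W                          ≤⟨ ℕ.*-monoˡ-≤ W 2^Ks^s≤ ⟩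
  (12 ℕ.* m) ℕ.^ s ℕ.* W                             ≡⟨ ^ℕ-distrib-* s (12 ℕ.* m) (v ℕ.^ 5 ℕ.* s ℕ.^ 4) ⟨
  (12 ℕ.* m ℕ.* (v ℕ.^ 5 ℕ.* s ℕ.^ 4)) ℕ.^ s         ≡⟨ cong (ℕ._^ s) (ℕ.[m*n]*[o*p]≡[m*o]*[n*p] 12 m (v ℕ.^ 5) (s ℕ.^ 4)) ⟩
  (12 ℕ.* v ℕ.^ 5 ℕ.* (m ℕ.* s ℕ.^ 4)) ℕ.^ s         ≤⟨ ℕ.^-monoˡ-≤ s (ℕ.*-mono-≤ 12v^5≤
                                                          (ℕ.*-monoʳ-≤ m (ℕ.^-monoˡ-≤ 4 s≤m))) ⟩
  ((2 ℕ.* u) ℕ.^ 5 ℕ.* m ℕ.^ 5) ℕ.^ s                ≡⟨ cong (ℕ._^ s) (^ℕ-distrib-* 5 (2 ℕ.* u) m) ⟨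
  ((2 ℕ.* u ℕ.* m) ℕ.^ 5) ℕ.^ s                      ≡⟨ ℕ.^-*-assoc (2 ℕ.* u ℕ.* m) 5 s ⟩
  (2 ℕ.* u ℕ.* m) ℕ.^ (5 ℕ.* s)                      ≡⟨ cong (ℕ._^ (5 ℕ.* s)) (ℕ.*-assoc 2 u m) ⟩
  (2 ℕ.* (u ℕ.* m)) ℕ.^ (5 ℕ.* s)                    ≡⟨ ^ℕ-distrib-* (5 ℕ.* s) 2 (u ℕ.* m) ⟩
  2 ℕ.^ (5 ℕ.* s) ℕ.* (u ℕ.* m) ℕ.^ (5 ℕ.* s)        ∎
  where
  open ℕ.≤-Reasoning
  W : ℕ
  W = (v ℕ.^ 5 ℕ.* s ℕ.^ 4) ℕ.^ s
  swap : ∀ a b c → a ℕ.* (b ℕ.* c) ≡ b ℕ.* (a ℕ.* c)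
  swap = solve-∀

-- For p = (K - 5 s) / (5 s) one has 5 m s (1 + p) = m K, and p < log₂ (m / s)
-- is witnessed by y = 7 m / 8 s because 12 · 8 ^ 5 ≤ 14 ^ 5.
fromℕ≤c·[1+log₂] : ∀ m s K .{{_ : NonZero m}} .{{_ : NonZero s}} (0<x : Positive (fromℕ m ÷ s)) →
  s ℕ.≤ m → 2 ℕ.^ K ℕ.* s ℕ.^ s ℕ.≤ (12 ℕ.* m) ℕ.^ s →
  fromℕ (m ℕ.* K) ≤ℝ (5 ℕ.* (m ℕ.* s)) · (fromℕ 1 +ℝ log₂ (fromℕ m ÷ s) 0<x)
fromℕ≤c·[1+log₂] m@(suc _) s@(suc _) K 0<x s≤m 2^Ks^s≤ =
  ≤ℝ-trans {fromℕ (m ℕ.* K)} {fromℚ (ι c ℚ.* (ι 1 ℚ.+ p))} {c · z}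
    (fromℚ-mono-≤ (ℚ.≤-reflexive mK≃))
  (≤ℝ-trans {fromℚ (ι c ℚ.* (ι 1 ℚ.+ p))} {c · fromℚ (ι 1 ℚ.+ p)} {c · z} (fromℚ-*-≤ c (ι 1 ℚ.+ p))
  (·-monoʳ-≤ c {fromℚ (ι 1 ℚ.+ p)} {z}
  (≤ℝ-trans {fromℚ (ι 1 ℚ.+ p)} {fromℕ 1 +ℝ fromℚ p} {z} (fromℚ-+-≤ (ι 1) p)
  (+ℝ-mono-≤ {fromℕ 1} {fromℕ 1} {fromℚ p} {log₂ x 0<x} (λ q → q) (fromℚ≤log₂ {p} {x} 0<x p<log₂x)))))
  where
  c : ℕ
  c = 5 ℕ.* (m ℕ.* s)
  x z : ℝ
  x = fromℕ m ÷ s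
  z = fromℕ 1 +ℝ log₂ x 0<x
  p y : ℚᵘ
  p = (K ⊖ 5 ℕ.* s) ℚ./ (5 ℕ.* s)
  y = + (7 ℕ.* m) ℚ./ (8 ℕ.* s)
  mK≃ : ι (m ℕ.* K) ℚ.≃ ι c ℚ.* (ι 1 ℚ.+ p)
  mK≃ = begin-equality
    ι (m ℕ.* K)                                          ≃⟨ ι-* m K ⟩
    ι m ℚ.* ι K                                          ≃⟨ ℚ.*-congˡ {ι m} (ι≃ι+⊖ K (5 ℕ.* s)) ⟩
    ι m ℚ.* (ι (5 ℕ.* s) ℚ.+ (K ⊖ 5 ℕ.* s) ℚ./ 1)        ≃⟨ ℚ.*-congˡ {ι m} (ℚ.+-congʳ (ι (5 ℕ.* s)) (ι*/ (K ⊖ 5 ℕ.* s) (5 ℕ.* s))) ⟨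
    ι m ℚ.* (ι (5 ℕ.* s) ℚ.+ ι (5 ℕ.* s) ℚ.* p)          ≃⟨ solve 3 (λ m t p → m :* (t :+ t :* p) := m :* t :* (con 1ℚᵘ :+ p)) ℚ.≃-refl (ι m) (ι (5 ℕ.* s)) p ⟩
    ι m ℚ.* ι (5 ℕ.* s) ℚ.* (ι 1 ℚ.+ p)                  ≃⟨ ℚ.*-congʳ {ι 1 ℚ.+ p} (ι-* m (5 ℕ.* s)) ⟨
    ι (m ℕ.* (5 ℕ.* s)) ℚ.* (ι 1 ℚ.+ p)                  ≡⟨ cong (λ k → ι k ℚ.* (ι 1 ℚ.+ p)) (regroup m s) ⟩
    ι c ℚ.* (ι 1 ℚ.+ p)                                  ∎
    where
    open ℚ.≤-Reasoning
    regroup : ∀ m s → m ℕ.* (5 ℕ.* s) ≡ 5 ℕ.* (m ℕ.* s)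
    regroup = solve-∀
  sy<m : ι s ℚ.* y ℚ.< ι m
  sy<m = ℚ.*-cancelˡ-<-nonNeg (ι 8) (begin-strict
    ι 8 ℚ.* (ι s ℚ.* y)   ≃⟨ ℚ.*-assoc (ι 8) (ι s) y ⟨
    ι 8 ℚ.* ι s ℚ.* y     ≃⟨ ℚ.*-congʳ {y} (ι-* 8 s) ⟨
    ι (8 ℕ.* s) ℚ.* y     ≃⟨ ι*/ (+ (7 ℕ.* m)) (8 ℕ.* s) ⟩
    ι (7 ℕ.* m)           <⟨ ι-mono-< (ℕ.*-monoˡ-< m {7} {8} ℕ.≤-refl) ⟩
    ι (8 ℕ.* m)           ≃⟨ ι-* 8 m ⟩
    ι 8 ℚ.* ι m           ∎)
    where open ℚ.≤-Reasoning
  p<log₂x : p <log₂ x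
  p<log₂x = y , lower-÷ s (fromℕ m) (fromℚ-< sy<m) , ℚ.positive⁻¹ y ,
    2^⊖≤/^ K (5 ℕ.* s) (5 ℕ.* s) (7 ℕ.* m) (8 ℕ.* s) (scale-≤ 7 8 m s K s≤m (ℕ.≤ᵇ⇒≤ (12 ℕ.* 8 ℕ.^ 5) (14 ℕ.^ 5) _) 2^Ks^s≤)

-- For x = 1 and y = n the two terms in `tangent-≤` are both n ^ n.
n^n+n^n≤[1+n]^n : ∀ n .{{_ : NonZero n}} → n ℕ.^ n ℕ.+ n ℕ.^ n ℕ.≤ suc n ℕ.^ n
n^n+n^n≤[1+n]^n n@(suc k) = ι-cancel-≤ (begin
  ι (n ℕ.^ n ℕ.+ n ℕ.^ n)                          ≃⟨ ι-+ (n ℕ.^ n) (n ℕ.^ n) ⟩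
  ι (n ℕ.^ n) ℚ.+ ι (n ℕ.^ n)                      ≃⟨ ℚ.+-cong (ι-^ n n) (ι-^ n n) ⟨
  ι n ^ℚ n ℚ.+ ι n ℚ.* ι n ^ℚ k                    ≃⟨ ℚ.+-congʳ (ι n ^ℚ n) (ℚ.*-congˡ {ι n} (ℚ.*-identityˡ (ι n ^ℚ k))) ⟨
  ι n ^ℚ n ℚ.+ ι n ℚ.* (1ℚᵘ ℚ.* ι n ^ℚ k)          ≤⟨ tangent-≤ (ι-mono-≤ {0} {1} ℕ.z≤n) (ι-mono-≤ {0} {n} ℕ.z≤n) k ⟩
  (ι n ℚ.+ 1ℚᵘ) ^ℚ n                               ≃⟨ ^ℚ-congˡ n (ℚ.≃-trans (ι-+ 1 n) (ℚ.+-comm (ι 1) (ι n))) ⟨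
  ι (suc n) ^ℚ n                                   ≃⟨ ι-^ (suc n) n ⟩
  ι (suc n ℕ.^ n)                                  ∎)
  where open ℚ.≤-Reasoning

-- The exponent r + 1 / b exceeds r and is admissible as (1 + 1 / b) ^ b ≥ 2.
lower-log₂ : ∀ r b .{{_ : NonZero b}} {x} (0<x : Positive x) →
             lower x (+ (2 ℕ.^ r ℕ.* suc b) ℚ./ b) → lower (log₂ x 0<x) (ι r)
lower-log₂ r b@(suc _) 0<x y<x = + (suc (r ℕ.* b)) ℚ./ b ,
  (_ , y<x , 0<y ,
    2^⊖≤/^ (suc (r ℕ.* b)) 0 b (2 ℕ.^ r ℕ.* suc b) b (begin
      2 ℕ.* 2 ℕ.^ (r ℕ.* b) ℕ.* b ℕ.^ b          ≡⟨ regroup (2 ℕ.^ (r ℕ.* b)) (b ℕ.^ b) ⟩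
      2 ℕ.^ (r ℕ.* b) ℕ.* (b ℕ.^ b ℕ.+ b ℕ.^ b)  ≤⟨ ℕ.*-monoʳ-≤ (2 ℕ.^ (r ℕ.* b)) (n^n+n^n≤[1+n]^n b) ⟩
      2 ℕ.^ (r ℕ.* b) ℕ.* suc b ℕ.^ b            ≡⟨ cong (ℕ._* suc b ℕ.^ b) (ℕ.^-*-assoc 2 r b) ⟨
      (2 ℕ.^ r) ℕ.^ b ℕ.* suc b ℕ.^ b            ≡⟨ ^ℕ-distrib-* b (2 ℕ.^ r) (suc b) ⟨
      (2 ℕ.^ r ℕ.* suc b) ℕ.^ b                  ≡⟨ ℕ.*-identityˡ _ ⟨
      2 ℕ.^ 0 ℕ.* (2 ℕ.^ r ℕ.* suc b) ℕ.^ b      ∎)) ,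
  *<* (subst₂ ℤ._<_ (ℤ.pos-* r b) (sym (ℤ.*-identityʳ (+ suc (r ℕ.* b)))) (ℤ.+<+ ℕ.≤-refl))
  where
  open ℕ.≤-Reasoning
  regroup : ∀ x y → 2 ℕ.* x ℕ.* y ≡ x ℕ.* (y ℕ.+ y)
  regroup = solve-∀
  0<y : 0ℚᵘ ℚ.< + (2 ℕ.^ r ℕ.* suc b) ℚ./ b
  0<y = *<* (subst (+ 0 ℤ.<_) (sym (ℤ.*-identityʳ _)) (ℤ.+<+ (ℕ.*-mono-≤ (ℕ.m^n>0 2 r) (ℕ.s≤s ℕ.z≤n))))

-- By contraposition: 2 ^ r Δ < m would put `r` into the lower class of the logarithm, and hence
-- below itself.
log₂≤⇒≤2^* : ∀ m Δ r .{{_ : NonZero Δ}} (0<x : Positive (fromℕ m ÷ Δ)) →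
             log₂ (fromℕ m ÷ Δ) 0<x ≤ℝ fromℕ r → m ℕ.≤ 2 ℕ.^ r ℕ.* Δ
log₂≤⇒≤2^* m Δ r 0<x log≤r = ℕ.≮⇒≥ λ A<m → ℚ.<-irrefl (ℚ.≃-refl {ι r})
  (fromℚ-<⁻¹ {ι r} {ι r} (log≤r (lower-log₂ r b {fromℕ m ÷ Δ} 0<x (lower-÷ Δ (fromℕ m) (fromℚ-< (Δy<m A<m))))))
  where
  A b : ℕ
  A = 2 ℕ.^ r ℕ.* Δ
  -- With this choice Δ y = A (1 + 1 / b) = A + 1/2, which is still below m because A + 1 ≤ m.
  b = 2 ℕ.* A
  instance
    A≢0 : NonZero A
    A≢0 = ℕ.m*n≢0 (2 ℕ.^ r) Δ {{ℕ.m^n≢0 2 r}}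
    b≢0 : NonZero b
    b≢0 = ℕ.m*n≢0 2 A
  y : ℚᵘ
  y = + (2 ℕ.^ r ℕ.* suc b) ℚ./ b
  scale : ∀ d x y → d ℕ.* (x ℕ.* y) ≡ x ℕ.* d ℕ.* y
  scale = solve-∀
  double : ∀ a → a ℕ.* (2 ℕ.+ 2 ℕ.* a) ≡ 2 ℕ.* a ℕ.* (1 ℕ.+ a)
  double = solve-∀
  Δ[bA+A]<bm : A ℕ.< m → Δ ℕ.* (2 ℕ.^ r ℕ.* suc b) ℕ.< b ℕ.* m
  Δ[bA+A]<bm A<m = begin-strict
    Δ ℕ.* (2 ℕ.^ r ℕ.* suc b)   ≡⟨ scale Δ (2 ℕ.^ r) (suc b) ⟩
    A ℕ.* suc b                 <⟨ ℕ.*-monoʳ-< A (ℕ.≤-refl {suc (suc b)}) ⟩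
    A ℕ.* suc (suc b)           ≡⟨ double A ⟩
    b ℕ.* suc A                 ≤⟨ ℕ.*-monoʳ-≤ b A<m ⟩
    b ℕ.* m                     ∎
    where open ℕ.≤-Reasoning
  Δy<m : A ℕ.< m → ι Δ ℚ.* y ℚ.< ι m
  Δy<m A<m = ℚ.*-cancelˡ-<-nonNeg (ι b) (begin-strict
    ι b ℚ.* (ι Δ ℚ.* y)              ≃⟨ solve 3 (λ b d y → b :* (d :* y) := d :* (b :* y)) ℚ.≃-refl (ι b) (ι Δ) y ⟩
    ι Δ ℚ.* (ι b ℚ.* y)              ≃⟨ ℚ.*-congˡ {ι Δ} (ι*/ (+ (2 ℕ.^ r ℕ.* suc b)) b) ⟩
    ι Δ ℚ.* ι (2 ℕ.^ r ℕ.* suc b)    ≃⟨ ι-* Δ (2 ℕ.^ r ℕ.* suc b) ⟨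
    ι (Δ ℕ.* (2 ℕ.^ r ℕ.* suc b))    <⟨ ι-mono-< (Δ[bA+A]<bm A<m) ⟩
    ι (b ℕ.* m)                      ≃⟨ ι-* b m ⟩
    ι b ℚ.* ι m                      ∎)
    where open ℚ.≤-Reasoning

-- Finite sums and counting

private
  variable
    A B P Q : Set

-- Iverson bracket. It turns lengths of filtered lists into sums, whose order can be exchanged.
[_]? : Dec P → ℕ
[ P? ]? = if does P? then 1 else 0

[]?-cong : P ⇔ Q → (P? : Dec P) (Q? : Dec Q) → [ P? ]? ≡ [ Q? ]?
[]?-cong P⇔Q P? Q? = cong (if_then 1 else 0) (does-⇔ P⇔Q P? Q?)

[]?-no : (P? : Dec P) → ¬ P → [ P? ]? ≡ 0
[]?-no P? ¬p = cong (if_then 1 else 0) (dec-false P? ¬p)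

[]?-yes : (P? : Dec P) → P → [ P? ]? ≡ 1
[]?-yes P? p = cong (if_then 1 else 0) (dec-true P? p)

sum-cong : {f g : A → ℕ} → (∀ x → f x ≡ g x) → ∀ xs → sum (map f xs) ≡ sum (map g xs)
sum-cong f≗g xs = cong sum (map-cong f≗g xs)

sum-zero : {f : A → ℕ} → (∀ x → f x ≡ 0) → ∀ xs → sum (map f xs) ≡ 0
sum-zero f≡0 []       = refl
sum-zero f≡0 (x ∷ xs) = cong₂ _+_ (f≡0 x) (sum-zero f≡0 xs)

sum-+ : ∀ (f g : A → ℕ) xs → sum (map (λ x → f x + g x) xs) ≡ sum (map f xs) + sum (map g xs)
sum-+ f g []       = refl
sum-+ f g (x ∷ xs) = trans (cong (_+_ (f x + g x)) (sum-+ f g xs))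
  (+-interchange (f x) (g x) (sum (map f xs)) (sum (map g xs)))
  where
  +-interchange : ∀ a b c d → a + b + (c + d) ≡ a + c + (b + d)
  +-interchange = solve-∀

sum-* : ∀ c (f : A → ℕ) xs → sum (map (λ x → c * f x) xs) ≡ c * sum (map f xs)
sum-* c f []       = sym (*-zeroʳ c)
sum-* c f (x ∷ xs) = trans (cong (_+_ (c * f x)) (sum-* c f xs)) (sym (*-distribˡ-+ c (f x) (sum (map f xs))))

sum-swap : ∀ (f : A → B → ℕ) xs ys →
           sum (map (λ x → sum (map (f x) ys)) xs) ≡ sum (map (λ y → sum (map (λ x → f x y) xs)) ys)
sum-swap f []       ys = sym (sum-zero (λ _ → refl) ys)
sum-swap f (x ∷ xs) ys = trans (cong (_+_ (sum (map (f x) ys))) (sum-swap f xs ys))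
  (sym (sum-+ (f x) (λ y → sum (map (λ x → f x y) xs)) ys))

sum-mono-≤ : {f g : A → ℕ} → (∀ x → f x ≤ g x) → ∀ xs → sum (map f xs) ≤ sum (map g xs)
sum-mono-≤ f≤g []       = z≤n
sum-mono-≤ f≤g (x ∷ xs) = +-mono-≤ (f≤g x) (sum-mono-≤ f≤g xs)

sum-mono-< : {f g : A → ℕ} → (∀ x → f x ≤ g x) →
             ∀ {xs} → Any (λ x → f x < g x) xs → sum (map f xs) < sum (map g xs)
sum-mono-< f≤g {_ ∷ xs} (here fx<gx)     = +-mono-<-≤ fx<gx (sum-mono-≤ f≤g xs)
sum-mono-< f≤g {x ∷ _}  (there any-fx<gx) = +-mono-≤-< (f≤g x) (sum-mono-< f≤g any-fx<gx)

sum-filter : {P : A → Set} (P? : Decidable P) (f : A → ℕ) → (∀ x → ¬ P x → f x ≡ 0) →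
             ∀ xs → sum (map f (filter P? xs)) ≡ sum (map f xs)
sum-filter P? f f≡0 []       = refl
sum-filter P? f f≡0 (x ∷ xs) with P? x
... | yes _  = cong (_+_ (f x)) (sum-filter P? f f≡0 xs)
... | no ¬px = trans (sum-filter P? f f≡0 xs) (cong (_+ sum (map f xs)) (sym (f≡0 x ¬px)))

length-filter : {P : A → Set} (P? : Decidable P) → ∀ xs →
                length (filter P? xs) ≡ sum (map (λ x → [ P? x ]?) xs)
length-filter P? []       = refl
length-filter P? (x ∷ xs) with P? x
... | yes _ = cong suc (length-filter P? xs)
... | no  _ = length-filter P? xs

length-mapMaybe-dec : {P : A → Set} (P? : Decidable P) (g : ∀ x → P x → B) → ∀ xs →
  length (mapMaybe (λ x → Maybe.map (g x) (dec⇒maybe (P? x))) xs) ≡ sum (map (λ x → [ P? x ]?) xs)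
length-mapMaybe-dec P? g []       = refl
length-mapMaybe-dec P? g (x ∷ xs) with P? x
... | yes _ = cong suc (length-mapMaybe-dec P? g xs)
... | no  _ = length-mapMaybe-dec P? g xs

length-concatMap : ∀ (f : A → List B) xs → length (concatMap f xs) ≡ sum (map (length ∘ f) xs)
length-concatMap f []       = refl
length-concatMap f (x ∷ xs) = trans (length-++ (f x)) (cong (_+_ (length (f x))) (length-concatMap f xs))

∑<-suc : ∀ n f → ∑< (suc n) f ≡ f 0 + ∑< n (f ∘ suc)
∑<-suc n f = cong (λ xs → f 0 + sum xs) (trans (map-applyUpTo suc f n) (sym (map-upTo (f ∘ suc) n)))

∑<-extend : ∀ r d {f} → (∀ {k} → r ≤ k → f k ≡ 0) → ∑< (r + d) f ≡ ∑< r f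
∑<-extend zero    d {f} f≡0 = sum-zero (λ k → f≡0 z≤n) (upTo d)
∑<-extend (suc r) d {f} f≡0 = trans (∑<-suc (r + d) f)
  (trans (cong (_+_ (f 0)) (∑<-extend r d (f≡0 ∘ s≤s))) (sym (∑<-suc r f)))

-- Both sides are truncations of one infinite sum. Each is compared with the range r + n, so it need
-- not be known which bound is larger.
∑<-support : ∀ r n {f} → (∀ {k} → r ≤ k → f k ≡ 0) → (∀ {k} → n ≤ k → f k ≡ 0) → ∑< r f ≡ ∑< n f
∑<-support r n {f} f≡0ʳ f≡0ⁿ = trans (sym (∑<-extend r n f≡0ʳ))
  (trans (cong (λ k → ∑< k f) (+-comm r n)) (∑<-extend n r f≡0ⁿ))

∑-allFin : ∀ n f → sum (map (f ∘ toℕ) (allFin n)) ≡ ∑< n f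
∑-allFin n f = trans (cong sum (map-tabulate {n = n} id (f ∘ toℕ))) (go n f)
  where
  go : ∀ n f → sum (tabulate {n = n} (f ∘ toℕ)) ≡ ∑< n f
  go zero    f = refl
  go (suc n) f = trans (cong (_+_ (f 0)) (go n (f ∘ suc))) (sym (∑<-suc n f))

∑<-[<?] : ∀ n c → ∑[ i < n ] [ i <? c ]? ≡ n ⊓ c
∑<-[<?] zero    c       = refl
∑<-[<?] (suc n) zero    = sum-zero (λ i → []?-no (i <? 0) λ ()) (upTo (suc n))
∑<-[<?] (suc n) (suc c) = trans (∑<-suc n (λ i → [ i <? suc c ]?)) (cong suc
  (trans (sum-cong (λ i → []?-cong (mk⇔ s<s⁻¹ s<s) (suc i <? suc c) (i <? c)) (upTo n)) (∑<-[<?] n c)))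

m<o∸n⇒m+n<o : ∀ m n o → m < o ∸ n → m + n < o
m<o∸n⇒m+n<o m zero    o       m<o   = subst (_< o) (sym (+-identityʳ m)) m<o
m<o∸n⇒m+n<o m (suc n) (suc o) m<o∸n = subst (_< suc o) (sym (+-suc m n)) (s<s (m<o∸n⇒m+n<o m n o m<o∸n))

∑-allFin-[+<?] : ∀ m d → sum (map (λ i → [ toℕ i + d <? m ]?) (allFin m)) ≡ m ∸ d
∑-allFin-[+<?] m d = begin
  sum (map (λ i → [ toℕ i + d <? m ]?) (allFin m))  ≡⟨ ∑-allFin m (λ i → [ i + d <? m ]?) ⟩
  ∑[ i < m ] [ i + d <? m ]?                        ≡⟨ sum-cong (λ i → []?-cong (mk⇔ (m+n≤o⇒m≤o∸n (suc i)) (m<o∸n⇒m+n<o i d m)) (i + d <? m) (i <? m ∸ d)) (upTo m) ⟩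
  ∑[ i < m ] [ i <? m ∸ d ]?                        ≡⟨ ∑<-[<?] m (m ∸ d) ⟩
  m ⊓ (m ∸ d)                                       ≡⟨ m≥n⇒m⊓n≡n (m∸n≤m m d) ⟩
  m ∸ d                                             ∎
  where open ≡-Reasoning

length-elements : ∀ {m} (T : Subset m) → length (elements T) ≡ ∣ T ∣
length-elements {m} T = trans (length-filter (_∈? T) (allFin m)) (trans (cong sum (map-tabulate id (λ t → [ t ∈? T ]?))) (go T))
  where
  go : ∀ {m} (T : Subset m) → sum (tabulate (λ t → [ t ∈? T ]?)) ≡ ∣ T ∣
  go []            = refl
  go (inside ∷ T)  = cong suc (go T)
  go (outside ∷ T) = go T

length≤head : ∀ {x xs} → AllPairs _>_ (x ∷ xs) → All (0 <_) (x ∷ xs) → length (x ∷ xs) ≤ x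
length≤head {xs = []}    _                     (0<x ∷ _) = 0<x
length≤head {xs = _ ∷ _} ((x>y ∷ _) ∷ sorted) (_ ∷ pos) = ≤-<-trans (length≤head sorted pos) x>y

-- Each entry is at least the number of entries from it onwards, so the factors dominate n, n - 1,
-- ..., 1.
length!≤product : ∀ {xs} → AllPairs _>_ xs → All (0 <_) xs → length xs ! ≤ product xs
length!≤product []                    []             = ≤-refl
length!≤product sorted@(_ ∷ sorted′) pos@(_ ∷ pos′) =
  *-mono-≤ (length≤head sorted pos) (length!≤product sorted′ pos′)

-- Contributions of the schedule

-- The sum counts doublings that start below m, and each of them ends below 2 m. The induction
-- passes from `d` to 2 d with `d` < 2 m as invariant.
∑<-doubling : ∀ {m} n d → d < 2 * m → 2 ^ (∑[ k < n ] [ 2 ^ k * d <? m ]?) * d < 2 * m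
∑<-doubling zero    d d<2m = subst (_< _) (sym (*-identityˡ d)) d<2m
∑<-doubling {m} (suc n) d d<2m with d <? m
... | yes d<m = begin-strict
  2 ^ ∑< (suc n) f * d            ≡⟨ cong (λ k → 2 ^ k * d) (trans (∑<-suc n f) (cong (_+ ∑< n (f ∘ suc)) ([]?-yes (1 * d <? m) (subst (_< m) (sym (*-identityˡ d)) d<m)))) ⟩
  2 * 2 ^ ∑< n (f ∘ suc) * d      ≡⟨ cong (_* d) (*-comm 2 (2 ^ ∑< n (f ∘ suc))) ⟩
  2 ^ ∑< n (f ∘ suc) * 2 * d      ≡⟨ *-assoc (2 ^ ∑< n (f ∘ suc)) 2 d ⟩
  2 ^ ∑< n (f ∘ suc) * (2 * d)    ≡⟨ cong (λ k → 2 ^ k * (2 * d)) (sum-cong (λ k → cong (λ e → [ e <? m ]?) (2^suc k)) (upTo n)) ⟩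
  2 ^ ∑< n g * (2 * d)            <⟨ ∑<-doubling {m} n (2 * d) (*-monoʳ-< 2 d<m) ⟩
  2 * m                           ∎
  where
  open ≤-Reasoning
  f g : ℕ → ℕ
  f k = [ 2 ^ k * d <? m ]?
  g k = [ 2 ^ k * (2 * d) <? m ]?
  2^suc : ∀ k → 2 ^ suc k * d ≡ 2 ^ k * (2 * d)
  2^suc k = trans (cong (_* d) (*-comm 2 (2 ^ k))) (*-assoc (2 ^ k) 2 d)
-- From m ≤ d on every 2 ^ k d fails the test, so the count is zero and the invariant is the claim.
... | no d≮m = subst (λ k → 2 ^ k * d < 2 * m) (sym (sum-zero (λ k → []?-no (2 ^ k * d <? m)
  (λ 2^kd<m → d≮m (≤-<-trans (m≤n*m d (2 ^ k) {{m^n≢0 2 k}}) 2^kd<m))) (upTo (suc n))))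
  (subst (_< 2 * m) (sym (*-identityˡ d)) d<2m)

module _ {m : ℕ} where

  length-shiftContributions : ∀ d → length (shiftContributions {m} d) ≡ m ∸ d
  length-shiftContributions d =
    trans (length-mapMaybe-dec (λ i → toℕ i + d <? m) (λ i i+d<m → Fin.fromℕ< i+d<m , i) (allFin m)) (∑-allFin-[+<?] m d)

  length-lowContributions : ∀ (t : Fin m) → length (lowContributions t) ≡ Δ t
  length-lowContributions t =
    trans (length-mapMaybe-dec (λ j → toℕ j + toℕ t <? m) (λ j j+t<m → j , Fin.fromℕ< j+t<m) (allFin m)) (∑-allFin-[+<?] m (toℕ t))

  Δ>0 : ∀ (t : Fin m) → 0 < Δ t
  Δ>0 t = m<n⇒0<n∸m (toℕ<n t)

  -- The stage count and the condition U ≠ 0 are phrased through negations; a search of the finite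
  -- set decides the case and yields a concrete exponent.
  ∃-positive? : ∀ (T : Subset m) → Dec (∃[ t ] (t ∈ T × toℕ t ≢ 0))
  ∃-positive? T = any? (λ t → t ∈? T ×-dec ¬? (toℕ t ≟ 0))

  ∄⇒all-zero : ∀ {T : Subset m} → ¬ (∃[ t ] (t ∈ T × toℕ t ≢ 0)) → ∀ t → t ∈ T → toℕ t ≡ 0
  ∄⇒all-zero ∄ t t∈T = decidable-stable (toℕ t ≟ 0) (λ t≢0 → ∄ (t , t∈T , t≢0))

  N^-≥ : ∀ {d} → m ≤ d → ∀ y i → N^ {m} d y i ≡ 0ℙ
  N^-≥ {d} m≤d y i with toℕ i + d <? m
  ... | yes i+d<m = contradiction (≤-<-trans (m≤n+m d (toℕ i)) i+d<m) (≤⇒≯ m≤d)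
  ... | no  _     = refl

  -- The exponent 0 has Δ = m, and shifting by m leaves nothing. Read backwards, U ≠ 0 provides an
  -- exponent with Δ t < m.
  all-zero⇒U≡0 : ∀ {T : Subset m} → (∀ t → t ∈ T → toℕ t ≡ 0) → ∀ y i → U T y i ≡ 0ℙ
  all-zero⇒U≡0 {T} all-zero y i = go (All.map (λ {t} → all-zero t) (All.all-filter (_∈? T) (allFin m)))
    where
    go : ∀ {ts} → All (λ t → toℕ t ≡ 0) ts → foldr ℙ._+_ 0ℙ (map (λ t → N^ (Δ {m} t) y i) ts) ≡ 0ℙ
    go []           = refl
    go (t≡0 ∷ ts≡0) = cong₂ ℙ._+_ (N^-≥ (≤-reflexive (cong (m ∸_) (sym t≡0))) y i) (go ts≡0)

  S-fb≡∑h : ∀ (T : Subset m) r → S-fb T r ≡ ∑[ k < r ] h T k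
  S-fb≡∑h T r = trans (length-concatMap (λ k → map (k ,_) (active T k)) (upTo r))
    (sum-cong (λ k → length-map (k ,_) (active T k)) (upTo r))

  -- Truncated subtraction is the positive part, so inactive exponents may be included with value 0.
  length-stageContributions : ∀ (T : Subset m) k →
    length (stageContributions T k) ≡ ∑[ t ∈ T ] (m ∸ 2 ^ k * Δ t)
  length-stageContributions T k = begin
    length (stageContributions T k)
      ≡⟨ length-concatMap (λ t → shiftContributions (2 ^ k * Δ t)) (active T k) ⟩
    sum (map (λ t → length (shiftContributions {m} (2 ^ k * Δ t))) (active T k))
      ≡⟨ sum-cong (λ t → length-shiftContributions (2 ^ k * Δ t)) (active T k) ⟩
    sum (map (λ t → m ∸ 2 ^ k * Δ t) (active T k))
      ≡⟨ sum-filter (λ t → 2 ^ k * Δ t <? m) (λ t → m ∸ 2 ^ k * Δ t) (λ t 2^kΔ≮m → m≤n⇒m∸n≡0 (≮⇒≥ 2^kΔ≮m)) (elements T) ⟩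
    ∑[ t ∈ T ] (m ∸ 2 ^ k * Δ t) ∎
    where open ≡-Reasoning

  W-V≡∑Δ : ∀ (T : Subset m) → W-V T ≡ ∑[ t ∈ T ] Δ t
  W-V≡∑Δ T = trans (length-concatMap lowContributions (elements T))
    (sum-cong length-lowContributions (elements T))

  ∑[]?≡ℓ : ∀ (t : Fin m) → ∑[ k < m ] [ 2 ^ k * Δ t <? m ]? ≡ ℓ t
  ∑[]?≡ℓ t = sym (length-filter (λ k → 2 ^ k * Δ t <? m) (upTo m))

  2^ℓ*Δ<2m : ∀ (t : Fin m) → 2 ^ ℓ t * Δ t < 2 * m
  2^ℓ*Δ<2m t = subst (λ k → 2 ^ k * Δ t < 2 * m) (∑[]?≡ℓ t)
    (∑<-doubling {m} m (Δ t) (≤-<-trans (m∸n≤m m (toℕ t)) (m<m+n m (subst (0 <_) (sym (+-identityʳ m)) (≤-<-trans z≤n (toℕ<n t))))))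

  -- A strict bound by (2 m) ^ length would fail for the empty list. The integers 2 ^ ℓ t · Δ t are
  -- at most 2 m - 1, and `2^∑ℓ*s!<` recovers strictness from the nonzero exponent.
  2^∑ℓ*∏Δ≤ : ∀ (ts : List (Fin m)) → 2 ^ sum (map ℓ ts) * product (map Δ ts) ≤ (2 * m ∸ 1) ^ length ts
  2^∑ℓ*∏Δ≤ []       = ≤-refl
  2^∑ℓ*∏Δ≤ (t ∷ ts) = begin
    2 ^ (ℓ t + L) * (Δ t * D)          ≡⟨ cong (_* (Δ t * D)) (^-distribˡ-+-* 2 (ℓ t) L) ⟩
    2 ^ ℓ t * 2 ^ L * (Δ t * D)        ≡⟨ [m*n]*[o*p]≡[m*o]*[n*p] (2 ^ ℓ t) (2 ^ L) (Δ t) D ⟩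
    2 ^ ℓ t * Δ t * (2 ^ L * D)        ≤⟨ *-mono-≤ (<⇒≤pred (2^ℓ*Δ<2m t)) (2^∑ℓ*∏Δ≤ ts) ⟩
    pred (2 * m) * (2 * m ∸ 1) ^ length ts ≡⟨ cong (_* (2 * m ∸ 1) ^ length ts) (pred[m∸n]≡m∸[1+n] (2 * m) 0) ⟩
    (2 * m ∸ 1) ^ suc (length ts)      ∎
    where
    open ≤-Reasoning
    L D : ℕ
    L = sum (map ℓ ts)
    D = product (map Δ ts)

  ∣T∣!≤∏Δ : ∀ (T : Subset m) → ∣ T ∣ ! ≤ product (map Δ (elements T))
  ∣T∣!≤∏Δ T = subst (λ n → n ! ≤ product (map Δ (elements T)))
    (trans (length-map Δ (elements T)) (length-elements T))
    (length!≤product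
      -- `elements` lists the exponents in increasing order, so Δ strictly decreases along it.
      (AllPairs.map⁺ (AllPairs.filter⁺ (_∈? T) (AllPairs.tabulate⁺-< {f = id} (λ {i} {j} i<j → ∸-monoʳ-< i<j (<⇒≤ (toℕ<n j))))))
      (All.map⁺ (All.universal Δ>0 (elements T))))

  2^∑ℓ*s!< : ∀ (T : Subset m) .{{_ : NonZero m}} .{{_ : NonZero ∣ T ∣}} →
             2 ^ (∑[ t ∈ T ] ℓ t) * ∣ T ∣ ! < 2 ^ ∣ T ∣ * m ^ ∣ T ∣
  2^∑ℓ*s!< T = begin-strict
    2 ^ (∑[ t ∈ T ] ℓ t) * ∣ T ∣ !                       ≤⟨ *-monoʳ-≤ (2 ^ (∑[ t ∈ T ] ℓ t)) (∣T∣!≤∏Δ T) ⟩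
    2 ^ (∑[ t ∈ T ] ℓ t) * product (map Δ (elements T))  ≤⟨ 2^∑ℓ*∏Δ≤ (elements T) ⟩
    (2 * m ∸ 1) ^ length (elements T)                   ≡⟨ cong ((2 * m ∸ 1) ^_) (length-elements T) ⟩
    (2 * m ∸ 1) ^ ∣ T ∣                                 <⟨ ^-monoˡ-< ∣ T ∣ (∸-monoʳ-< {2 * m} {1} {0} (s≤s z≤n) (>-nonZero⁻¹ (2 * m) {{m*n≢0 2 m}})) ⟩
    (2 * m) ^ ∣ T ∣                                     ≡⟨ ^ℕ-distrib-* ∣ T ∣ 2 m ⟩
    2 ^ ∣ T ∣ * m ^ ∣ T ∣                               ∎
    where open ≤-Reasoning

  module _ .{{_ : NonZero m}} {T : Subset m} {r : ℕ} (stages : IsStageCount T r) where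

    -- When all exponents are 0, Δ t is m itself. Otherwise the ceiling condition gives m ≤ 2 ^ r
    -- Δmin, and Δmin ≤ Δ t. Here the real-valued definition of `r` meets the schedule.
    finished : ∀ {t : Fin m} → t ∈ T → ∀ {k} → r ≤ k → m ≤ 2 ^ k * Δ t
    finished {t} t∈T {k} r≤k with ∃-positive? T
    ... | no ∄t≢0 = begin
      m             ≡⟨ cong (m ∸_) (∄⇒all-zero ∄t≢0 t t∈T) ⟨
      Δ t           ≤⟨ m≤n*m (Δ t) (2 ^ k) {{m^n≢0 2 k}} ⟩
      2 ^ k * Δ t   ∎
      where open ≤-Reasoning
    ... | yes (t′ , t′∈T , t′≢0) = begin
      m                ≤⟨ log₂≤⇒≤2^* m (Δmin T) r {{Δmin-nonZero T}}
                            (÷-positive {fromℕ m} (Δmin T) {{Δmin-nonZero T}} (fromℕ-positive m)) (proj₁ (proj₂ stages (λ all-zero → t′≢0 (all-zero t′ t′∈T)))) ⟩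
      2 ^ r * Δmin T   ≤⟨ *-mono-≤ (^-monoʳ-≤ 2 r≤k) (All.lookup (min≤xs m (map Δ (elements T))) (∈-map⁺ Δ (∈-filter⁺ (_∈? T) (∈-allFin t) t∈T))) ⟩
      2 ^ k * Δ t      ∎
      where open ≤-Reasoning

    -- Double counting of pairs of a stage and an exponent. For each t in `T` the terms vanish from
    -- `r` on by `finished` and from m on by `inactive`.
    ∑<r≡∑<m : ∀ (f : ℕ → Fin m → ℕ) → (∀ k t → m ≤ 2 ^ k * Δ t → f k t ≡ 0) →
              ∑[ k < r ] ∑[ t ∈ T ] f k t ≡ ∑[ t ∈ T ] ∑[ k < m ] f k t
    ∑<r≡∑<m f f≡0 = trans (sum-swap f (upTo r) (elements T)) (cong sum (map-cong-local
      (All.map (λ {t} t∈T → ∑<-support r m (λ {k} r≤k → f≡0 k t (finished t∈T r≤k)) (λ {k} m≤k → f≡0 k t (inactive t m≤k)))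
        (All.all-filter (_∈? T) (allFin m)))))

    ∑h≡∑ℓ : ∑[ k < r ] h T k ≡ ∑[ t ∈ T ] ℓ t
    ∑h≡∑ℓ = trans (sum-cong (λ k → length-filter (λ t → 2 ^ k * Δ t <? m) (elements T)) (upTo r))
      (trans (∑<r≡∑<m (λ k t → [ 2 ^ k * Δ t <? m ]?) (λ k t m≤ → []?-no (2 ^ k * Δ t <? m) (≤⇒≯ m≤)))
        (sum-cong ∑[]?≡ℓ (elements T)))

    W-fb≡∑ : W-fb T r ≡ ∑[ t ∈ T ] ∑-positive-parts t
    W-fb≡∑ = trans (sum-cong (length-stageContributions T) (upTo r))
      (∑<r≡∑<m (λ k t → m ∸ 2 ^ k * Δ t) (λ k t → m≤n⇒m∸n≡0))

    S-fb≡∑ℓ : S-fb T r ≡ ∑[ t ∈ T ] ℓ t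
    S-fb≡∑ℓ = trans (S-fb≡∑h T r) ∑h≡∑ℓ

  positive-part≤ : ∀ (t : Fin m) k → m ∸ 2 ^ k * Δ t ≤ m * [ 2 ^ k * Δ t <? m ]?
  positive-part≤ t k = go (2 ^ k * Δ t <? m)
    where
    go : ∀ {d} (d<?m : Dec (d < m)) → m ∸ d ≤ m * [ d<?m ]?
    go {d} (yes _)  = ≤-trans (m∸n≤m m d) (≤-reflexive (sym (*-identityʳ m)))
    go (no d≮m) = ≤-reflexive (trans (m≤n⇒m∸n≡0 (≮⇒≥ d≮m)) (sym (*-zeroʳ m)))

  ∑[]?≡m*ℓ : ∀ (t : Fin m) → ∑[ k < m ] (m * [ 2 ^ k * Δ t <? m ]?) ≡ m * ℓ t
  ∑[]?≡m*ℓ t = trans (sum-* m (λ k → [ 2 ^ k * Δ t <? m ]?) (upTo m)) (cong (m *_) (∑[]?≡ℓ t))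

  ∑-positive-parts≤ : ∀ (t : Fin m) → ∑-positive-parts t ≤ m * ℓ t
  ∑-positive-parts≤ t = ≤-trans (sum-mono-≤ (positive-part≤ t) (upTo m)) (≤-reflexive (∑[]?≡m*ℓ t))

-- Strictness is gained in stage 0: t ≠ 0 gives Δ t < m, so this stage is counted by ℓ t but
-- contributes only m - Δ t < m. Matching on m exposes it as the head of `upTo m`.
∑-positive-parts< : ∀ {m} (t : Fin m) → toℕ t ≢ 0 → ∑-positive-parts t < m * ℓ t
∑-positive-parts< {m@(suc _)} t t≢0 = <-≤-trans
  (sum-mono-< (positive-part≤ t) {upTo m} (here (begin-strict
    m ∸ 1 * Δ t                ≡⟨ cong (m ∸_) (*-identityˡ (Δ t)) ⟩
    m ∸ Δ t                    <⟨ ∸-monoʳ-< (Δ>0 t) (m∸n≤m m (toℕ t)) ⟩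
    m                          ≡⟨ *-identityʳ m ⟨
    m * 1                      ≡⟨ cong (m *_) ([]?-yes (1 * Δ t <? m) (subst (_< m) (sym (*-identityˡ (Δ t)))
                                    (∸-monoʳ-< (n≢0⇒n>0 t≢0) (<⇒≤ (toℕ<n t))))) ⟨
    m * [ 1 * Δ t <? m ]?      ∎)))
  (≤-reflexive (∑[]?≡m*ℓ t))
  where open ≤-Reasoning

-- Bounds on the work

module _ {m : ℕ} .{{_ : NonZero m}} {T : Subset m} {r : ℕ} (stages : IsStageCount T r) where

  W-fb≤ : W-fb T r ≤ m * S-fb T r
  W-fb≤ = begin
    W-fb T r                          ≡⟨ W-fb≡∑ stages ⟩
    ∑[ t ∈ T ] ∑-positive-parts t     ≤⟨ sum-mono-≤ ∑-positive-parts≤ (elements T) ⟩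
    ∑[ t ∈ T ] (m * ℓ t)              ≡⟨ sum-* m ℓ (elements T) ⟩
    m * ∑[ t ∈ T ] ℓ t                ≡⟨ cong (m *_) (S-fb≡∑ℓ stages) ⟨
    m * S-fb T r                      ∎
    where open ≤-Reasoning

  W-fb< : ¬ (∀ y i → U T y i ≡ 0ℙ) → W-fb T r < m * S-fb T r
  W-fb< U≢0 with ∃-positive? T
  ... | no ∄t≢0 = contradiction (all-zero⇒U≡0 (∄⇒all-zero ∄t≢0)) U≢0
  ... | yes (t , t∈T , t≢0) = begin-strict
    W-fb T r                          ≡⟨ W-fb≡∑ stages ⟩
    ∑[ t ∈ T ] ∑-positive-parts t     <⟨ sum-mono-< ∑-positive-parts≤
                                           (lose (∈-filter⁺ (_∈? T) (∈-allFin t) t∈T) (∑-positive-parts< t t≢0)) ⟩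
    ∑[ t ∈ T ] (m * ℓ t)              ≡⟨ sum-* m ℓ (elements T) ⟩
    m * ∑[ t ∈ T ] ℓ t                ≡⟨ cong (m *_) (S-fb≡∑ℓ stages) ⟨
    m * S-fb T r                      ∎
    where open ≤-Reasoning

  W-V≤ : W-V T ≤ m * ∣ T ∣
  W-V≤ = begin
    W-V T                        ≡⟨ W-V≡∑Δ T ⟩
    ∑[ t ∈ T ] Δ t               ≤⟨ sum-mono-≤ (λ t → ≤-trans (m∸n≤m m (toℕ t)) (≤-reflexive (sym (*-identityʳ m)))) (elements T) ⟩
    ∑[ t ∈ T ] (m * 1)           ≡⟨ sum-* m (λ _ → 1) (elements T) ⟩
    m * ∑[ t ∈ T ] 1             ≡⟨ cong (m *_) (trans (sum-1 (elements T)) (length-elements T)) ⟩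
    m * ∣ T ∣                    ∎
    where
    open ≤-Reasoning
    sum-1 : ∀ (ts : List (Fin m)) → sum (map (λ _ → 1) ts) ≡ length ts
    sum-1 []       = refl
    sum-1 (_ ∷ ts) = cong suc (sum-1 ts)

  module _ .{{_ : NonZero ∣ T ∣}} where

    private
      s S : ℕ
      s = ∣ T ∣
      S = S-fb T r

    2^S-fb*s!< : 2 ^ S * s ! < 2 ^ s * m ^ s
    2^S-fb*s!< = subst (λ n → 2 ^ n * s ! < 2 ^ s * m ^ s) (sym (S-fb≡∑ℓ stages)) (2^∑ℓ*s!< T)

    -- In 12 = 2 · 2 · 3 one factor 2 comes from the bound on 2 ^ S · s!, the other from the added s
    -- in the exponent, and 3 from e ≤ 3.
    2^[S-fb+s]*s^s≤ : 2 ^ (S + s) * s ^ s ≤ (12 * m) ^ s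
    2^[S-fb+s]*s^s≤ = begin
      2 ^ (S + s) * s ^ s                 ≤⟨ *-monoʳ-≤ (2 ^ (S + s)) (n^n≤n!*3^n s) ⟩
      2 ^ (S + s) * (s ! * 3 ^ s)         ≡⟨ cong (_* (s ! * 3 ^ s)) (^-distribˡ-+-* 2 S s) ⟩
      2 ^ S * 2 ^ s * (s ! * 3 ^ s)       ≡⟨ [m*n]*[o*p]≡[m*o]*[n*p] (2 ^ S) (2 ^ s) (s !) (3 ^ s) ⟩
      2 ^ S * s ! * (2 ^ s * 3 ^ s)       ≤⟨ *-monoˡ-≤ (2 ^ s * 3 ^ s) (<⇒≤ 2^S-fb*s!<) ⟩
      2 ^ s * m ^ s * (2 ^ s * 3 ^ s)     ≡⟨ cong₂ _*_ (^ℕ-distrib-* s 2 m) (^ℕ-distrib-* s 2 3) ⟨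
      (2 * m) ^ s * 6 ^ s                 ≡⟨ ^ℕ-distrib-* s (2 * m) 6 ⟨
      (2 * m * 6) ^ s                     ≡⟨ cong (_^ s) (regroup m) ⟩
      (12 * m) ^ s                        ∎
      where
      open ≤-Reasoning
      regroup : ∀ m → 2 * m * 6 ≡ 12 * m
      regroup = solve-∀

    -- The allowance m (S + s) covers m S alone as well as feedback plus assembly, whose costs are
    -- at most m S and m s.
    fromℕ-work≤ : ∀ {n} → n ≤ m * (S + s) → (0<x : Positive (fromℕ m ÷ s)) →
                  fromℕ n ≤ℝ (5 * (m * s)) · (fromℕ 1 +ℝ log₂ (fromℕ m ÷ s) 0<x)
    fromℕ-work≤ {n} n≤ 0<x = ≤ℝ-trans {fromℕ n} {fromℕ (m * (S + s))}
      {(5 * (m * s)) · (fromℕ 1 +ℝ log₂ (fromℕ m ÷ s) 0<x)}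
      (fromℚ-mono-≤ (ι-mono-≤ n≤))
      (fromℕ≤c·[1+log₂] m s (S + s) 0<x (∣p∣≤n T) 2^[S-fb+s]*s^s≤)

theorem5p1 :
    (∀ (m : ℕ) .{{_ : NonZero m}} (T : Subset m) (r : ℕ) → IsStageCount T r →
      let s = ∣ T ∣ in
        S-fb T r ≡ ∑[ k < r ] h T k
      × ∑[ k < r ] h T k ≡ ∑[ t ∈ T ] ℓ t
      × W-fb T r ≡ ∑[ t ∈ T ] ∑-positive-parts t
      × W-V T ≡ ∑[ t ∈ T ] (m ∸ toℕ t)
      × ∑[ t ∈ T ] (m ∸ toℕ t) ≡ ∑[ t ∈ T ] Δ t
      × (.{{_ : NonZero s}} →
          let m^s/s!  = (fromℕ (m ^ s) ÷ (s !)) {{s !≢0}}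
              m^s/s!⁺ = ÷-positive {fromℕ (m ^ s)} (s !) {{s !≢0}} (fromℕ-positive (m ^ s) {{m^n≢0 m s}})
              em/s    = (m · e) ÷ s
              em/s⁺   = ÷-positive {m · e} s (·-positive m {e} e-positive)
          in
            fromℕ (S-fb T r) ≤ℝ fromℕ s +ℝ log₂ m^s/s! m^s/s!⁺
          × fromℕ s +ℝ log₂ m^s/s! m^s/s!⁺ ≤ℝ s · (fromℕ 1 +ℝ log₂ em/s em/s⁺)
          × W-fb T r ≤ m * S-fb T r)
      × (¬ (∀ y i → U T y i ≡ 0ℙ) → W-fb T r < m * S-fb T r))
  × (∃[ C ] ∀ (m : ℕ) .{{_ : NonZero m}} (T : Subset m) (r : ℕ) → IsStageCount T r →
      let s = ∣ T ∣ in .{{_ : NonZero s}} →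
      fromℕ (m * S-fb T r) ≤ℝ
        (C * (m * s)) · (fromℕ 1 +ℝ log₂ (fromℕ m ÷ s) (÷-positive {fromℕ m} s (fromℕ-positive m))))
  × (∃[ C ] ∀ (m : ℕ) .{{_ : NonZero m}} (T : Subset m) (r : ℕ) → IsStageCount T r →
      let s = ∣ T ∣ in .{{_ : NonZero s}} →
      fromℕ (W-fb T r + W-V T) ≤ℝ
        (C * (m * s)) · (fromℕ 1 +ℝ log₂ (fromℕ m ÷ s) (÷-positive {fromℕ m} s (fromℕ-positive m))))
theorem5p1 =
  (λ m T r stages → let s = ∣ T ∣ in
    S-fb≡∑h T r , ∑h≡∑ℓ stages , W-fb≡∑ stages , W-V≡∑Δ T , refl ,
    ( fromℕ≤s+log₂ (S-fb T r) s (m ^ s) (s !) {{s !≢0}}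
        (÷-positive {fromℕ (m ^ s)} (s !) {{s !≢0}} (fromℕ-positive (m ^ s) {{m^n≢0 m s}}))
        (2^S-fb*s!< stages)
    , log₂-m^s/s!≤ m s {{s!≢0 = s !≢0}}
        (÷-positive {fromℕ (m ^ s)} (s !) {{s !≢0}} (fromℕ-positive (m ^ s) {{m^n≢0 m s}}))
        (÷-positive {m · e} s (·-positive m {e} e-positive))
    , W-fb≤ stages) ,
    W-fb< stages) ,
  (5 , λ m T r stages → let s = ∣ T ∣ in fromℕ-work≤ stages
    (*-monoʳ-≤ m (m≤m+n (S-fb T r) s))
    (÷-positive {fromℕ m} s (fromℕ-positive m))) ,
  (5 , λ m T r stages → let s = ∣ T ∣ in fromℕ-work≤ stages
    (≤-trans (+-mono-≤ (W-fb≤ stages) (W-V≤ stages)) (≤-reflexive (sym (*-distribˡ-+ m (S-fb T r) s))))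
    (÷-positive {fromℕ m} s (fromℕ-positive m)))
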